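{- Let $n\ge 1$ and let $M$ be a finite monoid. Then $M\in\mathbf{V}_n$ if and only if $M$ satisfies both identities $u_n=v_n$ and $x^{\omega}=x\,x^{\omega}$.
   Context: For an element $m$ of a finite monoid, $m^{\omega}$ denotes the unique idempotent among the powers of $m$ of positive exponent. Terms are built from variables $x_1,x_2,\dots$ by concatenation and the unary operation $t\mapsto t^{\omega}$; they are evaluated in a finite monoid $M$ under a valuation of the variables in $M$. $M$ satisfies an identity $u=v$ (written $M\models(u=v)$) if $u$ and $v$ take equal values under every valuation into $M$. Terms $u_n,v_n$: $u_1=(x_1x_2)^{\omega}$, $v_1=(x_2x_1)^{\omega}$, and for $n\ge1$ $$u_{n+1}=(x_1\cdots x_{2n}x_{2n+1})^{\omega}\,u_n\,(x_{2n+2}x_1\cdots x_{2n})^{\omega},\qquad v_{n+1}=(x_1\cdots x_{2n}x_{2n+1})^{\omega}\,v_n\,(x_{2n+2}x_1\cdots x_{2n})^{\omega}.$$ A monoid $M$ divides a monoid $N$ if $M$ is a homomorphic image of a submonoid of $N$. A pseudovariety is a class of finite monoids closed under finite direct products and division. $\mathbf{J}$ is the pseudovariety of finite $\mathcal J$-trivial monoids, i.e. finite monoids $M$ such that $MsM=MtM$ implies $s=t$ for all $s,t\in M$. Two-sided semidirect product of pseudovarieties: for a finite alphabet $A$ and a homomorphism $\psi:A^*\to N$ into a finite monoid, let $\Sigma=N\times A\times N$, regarded as a finite alphabet, and define $\tau_\psi:A^*\to\Sigma^*$ by $\tau_\psi(a_1\cdots a_m)=\sigma_1\cdots\sigma_m$,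 where $\sigma_i=(\psi(a_1\cdots a_{i-1}),a_i,\psi(a_{i+1}\cdots a_m))$ (empty products give $1$). For pseudovarieties $\mathbf V,\mathbf W$, a finite monoid $M$ belongs to $\mathbf V\mathbin{**}\mathbf W$ if and only if, for a surjective homomorphism $\phi:A^*\to M$ with $A$ a finite alphabet, there exist homomorphisms $\psi:A^*\to N$ with $N\in\mathbf W$ and $h:(N\times A\times N)^*\to K$ with $K\in\mathbf V$ such that for all $v,w\in A^*$, $\psi(v)=\psi(w)$ and $h(\tau_\psi(v))=h(\tau_\psi(w))$ imply $\phi(v)=\phi(w)$. (This does not depend on the choice of $A$ and $\phi$, and $\mathbf V\mathbin{**}\mathbf W$ is a pseudovariety.) The pseudovarieties $\mathbf V_n$ are defined by $\mathbf V_1=\mathbf J$ and $\mathbf V_{n+1}=\mathbf V_n\mathbin{**}\mathbf J$ for $n\ge1$. -}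

module Defs where

open import Algebra.Bundles using (Monoid)
import Algebra.Definitions as AlgDefs
import Algebra.Properties.Monoid.Mult as Mult
open import Algebra.Morphism.Structures using (IsMonoidHomomorphism)
open import Algebra.Structures using (IsMonoid)
open import Data.Fin.Base using (Fin; toℕ)
open import Data.Fin.Properties using (pigeonhole)
open import Data.List.Base using (List; []; _∷_; _++_; [_]; map; upTo; ++-[]-rawMonoid)
open import Data.List.NonEmpty as List⁺ using (List⁺; _∷_; _++⁺_; foldr₁)
open import Data.Nat.Base using (ℕ; zero; suc; _+_; _*_; _∸_; NonZero)
import Data.Nat.Properties as ℕ
open import Data.Product.Base using (Σ-syntax; ∃₂; ∃-syntax; _×_; _,_; proj₁; proj₂)
open import Function.Base using (_∘_)
open import Function.Bundles using (_↔_; Inverse; Injection)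
open import Function.Definitions using (Surjective)
open import Relation.Binary.PropositionalEquality
  using (_≡_; refl; sym; trans; cong; cong₂; module ≡-Reasoning)
open import Function.Properties.Inverse using (↔⇒↣)
open import Level as Level using (Lift; 0ℓ)
open import Relation.Unary using (Pred; _≐_)

Finite : Set → Set
Finite A = ∃[ n ] (A ↔ Fin n)

-- Equality in the carrier is propositional, so that N × A × N can serve
-- literally as an alphabet in _**_ below: words over it see elements of N,
-- not representatives of them.
record FiniteMonoid : Set₁ where
  infixl 7 _∙_
  field
    Carrier  : Set
    _∙_      : Carrier → Carrier → Carrier
    ε        : Carrier
    isMonoid : IsMonoid _≡_ _∙_ ε
    finite   : Finite Carrier

  monoid : Monoid 0ℓ 0ℓ
  monoid = record { isMonoid = isMonoid }

  open Monoid monoid public using (rawMonoid; assoc; identityˡ; identityʳ)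

  -- The library writes iterated products additively: pow n m is mⁿ.
  open Mult monoid public
    using ()
    renaming ( _×_ to pow; ×-homo-+ to pow-+; ×-idem to pow-idem
             ; ×-assocˡ to pow-pow )

  open AlgDefs {A = Carrier} _≡_ public using (_IdempotentOn_)

  IsOmegaPower : Carrier → Carrier → Set
  IsOmegaPower m e = _∙_ IdempotentOn e × (∃[ k ] e ≡ pow (suc k) m)

  omegaPower-unique : ∀ {m e f} → IsOmegaPower m e → IsOmegaPower m f → e ≡ f
  omegaPower-unique {m} {e} {f} (ee , j , e≡) (ff , k , f≡) = begin
    e                           ≡⟨ pow-idem ee (suc k) ⟨
    pow (suc k) e               ≡⟨ cong (pow (suc k)) e≡ ⟩
    pow (suc k) (pow (suc j) m) ≡⟨ pow-pow m (suc k) (suc j) ⟩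
    pow (suc k * suc j) m       ≡⟨ cong (λ i → pow i m) (ℕ.*-comm (suc k) (suc j)) ⟩
    pow (suc j * suc k) m       ≡⟨ pow-pow m (suc j) (suc k) ⟨
    pow (suc j) (pow (suc k) m) ≡⟨ cong (pow (suc j)) f≡ ⟨
    pow (suc j) f               ≡⟨ pow-idem ff (suc j) ⟩
    f                           ∎
    where open ≡-Reasoning

  private
    power-cycle : ∀ m → ∃₂ λ a p → pow (suc a + suc p) m ≡ pow (suc a) m
    power-cycle m
      with i , j , i<j , eq ← pigeonhole (ℕ.n<1+n (proj₁ finite))
             (λ i → Inverse.to (proj₂ finite) (pow (suc (toℕ i)) m))
      = toℕ i , toℕ j ∸ suc (toℕ i) ,
        trans (cong (λ k → pow k m) index) (sym (injective eq))
      where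
      open Injection (↔⇒↣ (proj₂ finite)) using (injective)
      index : suc (toℕ i) + suc (toℕ j ∸ suc (toℕ i)) ≡ suc (toℕ j)
      index = trans (ℕ.+-suc (suc (toℕ i)) _) (cong suc (ℕ.m+[n∸m]≡n i<j))

    cycle-* : ∀ m a p → pow (a + p) m ≡ pow a m →
              ∀ k → pow (a + k * p) m ≡ pow a m
    cycle-* m a p eq zero    = cong (λ i → pow i m) (ℕ.+-identityʳ a)
    cycle-* m a p eq (suc k) = begin
      pow (a + (p + k * p)) m       ≡⟨ cong (λ i → pow i m) (ℕ.+-assoc a p (k * p)) ⟨
      pow (a + p + k * p) m         ≡⟨ pow-+ m (a + p) (k * p) ⟩
      pow (a + p) m ∙ pow (k * p) m ≡⟨ cong (_∙ pow (k * p) m) eq ⟩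
      pow a m ∙ pow (k * p) m       ≡⟨ pow-+ m a (k * p) ⟨
      pow (a + k * p) m             ≡⟨ cycle-* m a p eq k ⟩
      pow a m                       ∎
      where open ≡-Reasoning

  omegaPower : ∀ m → Σ[ e ∈ Carrier ] IsOmegaPower m e
  omegaPower m with a , p , eq ← power-cycle m = pow c m , idem , p + a * suc p , refl
    where
    c d : ℕ
    c = suc a * suc p
    d = c ∸ suc a

    split : d + suc a ≡ c
    split = ℕ.m∸n+n≡m (ℕ.m≤m*n (suc a) (suc p))

    open ≡-Reasoning
    idem : pow c m ∙ pow c m ≡ pow c m
    idem = begin
      pow c m ∙ pow c m           ≡⟨ pow-+ m c c ⟨
      pow (c + c) m               ≡⟨ cong (λ i → pow (i + c) m) split ⟨
      pow (d + suc a + c) m       ≡⟨ cong (λ i → pow i m) (ℕ.+-assoc d (suc a) c) ⟩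
      pow (d + (suc a + c)) m     ≡⟨ pow-+ m d (suc a + c) ⟩
      pow d m ∙ pow (suc a + c) m ≡⟨ cong (pow d m ∙_) (cycle-* m (suc a) (suc p) eq (suc a)) ⟩
      pow d m ∙ pow (suc a) m     ≡⟨ pow-+ m d (suc a) ⟨
      pow (d + suc a) m           ≡⟨ cong (λ i → pow i m) split ⟩
      pow c m                     ∎

  infix 8 _^ω
  _^ω : Carrier → Carrier
  m ^ω = proj₁ (omegaPower m)

-- The variables are x 1, x 2, …; x 0 exists but is not used.
infixr 7 _·_
infix  8 _^ω
data Term : Set where
  x   : ℕ → Term
  _·_ : Term → Term → Term
  _^ω : Term → Term

module _ (M : FiniteMonoid) where
  open FiniteMonoid M using (Carrier; _∙_) renaming (_^ω to _^ωᴹ)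

  ⟦_⟧ : Term → (ℕ → Carrier) → Carrier
  ⟦ x i ⟧   ρ = ρ i
  ⟦ s · t ⟧ ρ = ⟦ s ⟧ ρ ∙ ⟦ t ⟧ ρ
  ⟦ t ^ω ⟧  ρ = (⟦ t ⟧ ρ) ^ωᴹ

infix 4 _⊨_≈_
_⊨_≈_ : FiniteMonoid → Term → Term → Set
M ⊨ s ≈ t = ∀ ρ → ⟦_⟧ M s ρ ≡ ⟦_⟧ M t ρ

concat : List⁺ Term → Term
concat = foldr₁ _·_

-- The list x₁, …, xₖ.
vars : ℕ → List Term
vars k = map (x ∘ suc) (upTo k)

-- (x₁ ⋯ x₂ₙ x₂ₙ₊₁)^ω t (x₂ₙ₊₂ x₁ ⋯ x₂ₙ)^ω
extend : ℕ → Term → Term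
extend n t =
  concat (vars (2 * n) ++⁺ List⁺.[ x (2 * n + 1) ]) ^ω
  · t
  · concat (x (2 * n + 2) ∷ vars (2 * n)) ^ω

u v : (n : ℕ) → .{{NonZero n}} → Term
u 1               = (x 1 · x 2) ^ω
u (suc n@(suc _)) = extend n (u n)
v 1               = (x 2 · x 1) ^ω
v (suc n@(suc _)) = extend n (v n)

Class : Set₂
Class = Pred FiniteMonoid (Level.suc 0ℓ)

module _ (M : FiniteMonoid) where
  open FiniteMonoid M

  -- The two-sided ideal M s M.
  ideal : Carrier → Pred Carrier 0ℓ
  ideal s z = ∃₂ λ a b → z ≡ a ∙ s ∙ b

  JTrivial : Set
  JTrivial = ∀ s t → ideal s ≐ ideal t → s ≡ t

module _ {A : Set} (M : FiniteMonoid) where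
  open FiniteMonoid M

  IsHom : (List A → Carrier) → Set
  IsHom = IsMonoidHomomorphism (++-[]-rawMonoid A) rawMonoid

-- In go, the first argument is the prefix already read.
τ : {A N : Set} → (List A → N) → List A → List (N × A × N)
τ {A} {N} ψ = go []
  where
  go : List A → List A → List (N × A × N)
  go p []      = []
  go p (a ∷ s) = (ψ p , a , ψ s) ∷ go (p ++ [ a ]) s

module _ {A : Set} (M : FiniteMonoid) where
  open FiniteMonoid using (Carrier)

  Factors : Class → Class → (List A → Carrier M) → Set₁
  Factors V W φ =
    Σ[ N ∈ FiniteMonoid ] Σ[ K ∈ FiniteMonoid ]
    Σ[ ψ ∈ (List A → Carrier N) ]
    Σ[ h ∈ (List (Carrier N × A × Carrier N) → Carrier K) ]
      W N × V K × IsHom N ψ × IsHom K h ×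
      (∀ w w′ → ψ w ≡ ψ w′ → h (τ ψ w) ≡ h (τ ψ w′) → φ w ≡ φ w′)

-- Whether such a factorization exists depends neither on A nor on φ when V and
-- W are pseudovarieties; here both are quantified existentially.
infixl 6 _**_
_**_ : Class → Class → Class
(V ** W) M =
  Σ[ A ∈ Set ] Σ[ φ ∈ (List A → FiniteMonoid.Carrier M) ]
    Finite A × IsHom M φ × Surjective _≡_ _≡_ φ × Factors M V W φ

𝐉 : Class
𝐉 M = Lift _ (JTrivial M)

𝐕 : (n : ℕ) → .{{NonZero n}} → Class
𝐕 1               = 𝐉
𝐕 (suc n@(suc _)) = 𝐕 n ** 𝐉

-- Suppose M ∈ Vₙ ** J. If E and F map to idempotents of the J-trivial monoid N that have every letter of u as a
-- factor, then in E u F all letters of u carry the same context (ψ(E) , ψ(F)), so K evaluates u there as a plain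
-- word. Reading ω as a large common exponent, an identity s = t of K thus passes to x^ω s y^ω = x^ω t y^ω in M
-- when x and y contain the variables of s and t.
--
-- Conversely, uₙ₊₁ = vₙ₊₁ implies (xy)^ω (yx)^ω (xy)^ω = (xy)^ω, hence that every factor m of an idempotent h
-- satisfies h m R h and m h L h. Then a word leaves its R-class along letters that form a greedily matched subword,
-- so if N records the subwords of bounded length, ψ(w a) = ψ(w) implies w a R w in M, and dually for L. A letter a
-- in context (p , s) is a loop if p a = p and a s = s. A letter that is not a loop occurs at most once in τ(w) with
-- its context, so the order of these letters is given by the subwords of length two. Between two of them the context
-- (p , s) is constant, and a factor m matters only through y m z, where y and z are the values of the prefix and
-- the suffix and the letters of m stabilise the R-class of y and the L-class of z. The monoid of such m modulo
-- y c m d z = y c m′ d z satisfies uₙ = vₙ, because y c = y c (x₁⋯x₂ₙ t)^ω and d z = (t′ x₁⋯x₂ₙ)^ω d z for some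
-- t and t′. K is the product of these monoids and of the one recording subwords of length two.
module Submission where

open import Defs
import Algebra.Construct.Flip.Op as Flip
open import Algebra.Morphism.Structures using (IsMonoidHomomorphism; module IsMonoidHomomorphism)
open import Algebra.Structures using (IsMonoid)
open import Data.Bool.Base using (Bool; true; false; T; if_then_else_)
import Data.Bool.Properties as Bool
open import Data.Fin.Base as Fin using (Fin; zero; suc; fromℕ)
import Data.Fin.Properties as Fin
open import Data.List.Base as List
  using (List; []; _∷_; [_]; _++_; map; length; filter; reverse; upTo; applyUpTo; allFin; cartesianProductWith)
import Data.List.Properties as List
open import Data.List.Membership.Propositional using (_∈_)
open import Data.List.Membership.Propositional.Properties
  using (∈-map⁺; ∈-allFin; ∈-upTo⁺; ∈-upTo⁻; ∈-cartesianProductWith⁺)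
open import Data.List.NonEmpty as List⁺ using (List⁺; _∷_; _++⁺_; _∷⁺_)
open import Data.List.Relation.Binary.Sublist.Propositional
  using (_⊆_; []; _∷_; _∷ʳ_; ⊆-refl; ⊆-trans; minimum; to∈)
open import Data.List.Relation.Binary.Sublist.Propositional.Properties
  using (∷ˡ⁻; reverse⁺; filter⁺; filter-⊆; All-resp-⊆)
import Data.List.Relation.Binary.Sublist.Propositional.Properties as Sublist
open import Data.List.Relation.Unary.All as All using (All; []; _∷_)
import Data.List.Relation.Unary.All.Properties as All
open import Data.List.Relation.Unary.Any using (here; there)
open import Data.Nat.Base as ℕ using (ℕ; zero; suc; NonZero; _+_; _*_; _<_; _≤_; s≤s; z≤n)
import Data.Nat.Properties as ℕ
import Data.Product.Function.Dependent.Propositional as ΣFun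
open import Data.Product.Base hiding (map)
open import Data.Product.Function.NonDependent.Propositional using (_×-↔_)
open import Data.Sum.Base using (_⊎_; inj₁; inj₂)
open import Data.Sum.Function.Propositional using (_⊎-↔_)
open import Data.Unit.Base using (⊤; tt)
open import Data.Vec.Base as Vec using (Vec; []; _∷_; lookup; tabulate)
import Data.Vec.Properties as Vec
open import Function.Base using (_∘_; id)
open import Function.Bundles using (_↔_; _⇔_; mk⇔; mk↔ₛ′; module Equivalence; module Inverse)
open import Function.Definitions using (Surjective)
open import Function.Properties.Inverse using (↔⇒↣; ↔-sym; ↔-refl; ↔-trans)
open import Level using (0ℓ; Lift; lift)
open import Relation.Binary.Bundles using (Setoid)
open import Relation.Binary.Definitions using (DecidableEquality)
open import Relation.Binary.PropositionalEquality hiding ([_])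
open import Relation.Nullary using (Dec; yes; no; ¬_; contradiction; ⌊_⌋; _×-dec_; _→-dec_; ¬?)
open import Relation.Nullary.Decidable
  using (True; toWitness; fromWitness; via-injection; map′; decidable-stable)
open import Relation.Unary using (Decidable)
open import Tactic.MonoidSolver using (solve)

-- Finite types

private
  variable
    A B : Set

-- Abstract, here and below, because unfolding finiteness proofs makes conversion checking explode.
abstract
  finite⇒≟ : Finite A → DecidableEquality A
  finite⇒≟ (_ , A↔) = via-injection (↔⇒↣ A↔) Fin._≟_

  all-finite? : Finite A → {P : A → Set} → (∀ a → Dec (P a)) → Dec (∀ a → P a)
  all-finite? (_ , A↔) {P} P? =
    map′ (λ f a → subst P (strictlyInverseʳ a) (f (to a))) (λ f i → f (from i)) (Fin.all? (P? ∘ from))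
    where open Inverse A↔

  any-finite? : Finite A → {P : A → Set} → (∀ a → Dec (P a)) → Dec (∃ P)
  any-finite? (_ , A↔) {P} P? =
    map′ (λ (i , p) → from i , p) (λ (a , p) → to a , subst P (sym (strictlyInverseʳ a)) p)
      (Fin.any? (P? ∘ from))
    where open Inverse A↔

  elements : Finite A → List A
  elements (n , A↔) = map (Inverse.from A↔) (allFin n)

  ∈-elements : (A-fin : Finite A) (a : A) → a ∈ elements A-fin
  ∈-elements (_ , A↔) a =
    subst (_∈ _) (Inverse.strictlyInverseʳ A↔ a) (∈-map⁺ (Inverse.from A↔) (∈-allFin _))

finite-⊤ : Finite ⊤
finite-⊤ = 1 , ↔-sym Fin.1↔⊤

finite-↔ : A ↔ B → Finite B → Finite A
finite-↔ A↔B (n , B↔) = n , ↔-trans A↔B B↔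

finite-× : Finite A → Finite B → Finite (A × B)
finite-× (m , A↔) (n , B↔) = m ℕ.* n , ↔-trans (A↔ ×-↔ B↔) (↔-sym Fin.*↔×)

finite-⊎ : Finite A → Finite B → Finite (A ⊎ B)
finite-⊎ (m , A↔) (n , B↔) = m ℕ.+ n , ↔-trans (A↔ ⊎-↔ B↔) (↔-sym Fin.+↔⊎)

finite-Vec : Finite A → ∀ n → Finite (Vec A n)
finite-Vec A-fin zero    = finite-↔ (mk↔ₛ′ _ (λ _ → []) (λ _ → refl) (λ { [] → refl })) finite-⊤
finite-Vec A-fin (suc n) =
  finite-↔ (mk↔ₛ′ Vec.uncons (uncurry _∷_) (λ _ → refl) (λ { (_ ∷ _) → refl }))
    (finite-× A-fin (finite-Vec A-fin n))

finite-T : ∀ b → Finite (T b)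
finite-T false = 0 , ↔-sym Fin.0↔⊥
finite-T true  = finite-⊤

finite-Σ-Fin : ∀ n (p : Fin n → Bool) → Finite (Σ (Fin n) (T ∘ p))
finite-Σ-Fin zero    p = 0 , mk↔ₛ′ proj₁ (λ ()) (λ ()) (λ ())
finite-Σ-Fin (suc n) p =
  finite-↔ (mk↔ₛ′ split join (λ { (inj₁ _) → refl ; (inj₂ _) → refl })
                     (λ { (zero , _) → refl ; (suc _ , _) → refl }))
    (finite-⊎ (finite-T (p zero)) (finite-Σ-Fin n (p ∘ suc)))
  where
  split : Σ (Fin (suc n)) (T ∘ p) → T (p zero) ⊎ Σ (Fin n) (T ∘ p ∘ suc)
  split (zero  , t) = inj₁ t
  split (suc i , t) = inj₂ (i , t)
  join : T (p zero) ⊎ Σ (Fin n) (T ∘ p ∘ suc) → Σ (Fin (suc n)) (T ∘ p)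
  join (inj₁ t)       = zero , t
  join (inj₂ (i , t)) = suc i , t

finite-Σ : Finite A → (p : A → Bool) → Finite (Σ A (T ∘ p))
finite-Σ {A} (n , A↔) p =
  finite-↔ (↔-sym (ΣFun.Σ-↔ {B = T ∘ p} (↔-sym A↔) (λ {i} → ↔-refl))) (finite-Σ-Fin n (p ∘ Inverse.from A↔))

-- Finite monoids, homomorphisms and products

open FiniteMonoid using (Carrier)

module _ {M : Set} {_∙_ : M → M → M} {ε : M} where

  mkIsMonoid : (∀ a b c → (a ∙ b) ∙ c ≡ a ∙ (b ∙ c)) → (∀ a → ε ∙ a ≡ a) → (∀ a → a ∙ ε ≡ a) →
               IsMonoid _≡_ _∙_ ε
  mkIsMonoid assoc idˡ idʳ = record
    { isSemigroup = record
      { isMagma = isMagma _∙_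
      ; assoc = assoc
      }
    ; identity = idˡ , idʳ
    }
    where open import Relation.Binary.PropositionalEquality.Algebra using (isMagma)

Property : Set₁
Property = FiniteMonoid → Set

IsMorphism : (M N : FiniteMonoid) → (Carrier M → Carrier N) → Set
IsMorphism M N = IsMonoidHomomorphism (FiniteMonoid.rawMonoid M) (FiniteMonoid.rawMonoid N)

module _ (M N : FiniteMonoid) where
  private
    module M = FiniteMonoid M
    module N = FiniteMonoid N

  mkMorphism : (θ : Carrier M → Carrier N) → (∀ a b → θ (a M.∙ b) ≡ θ a N.∙ θ b) → θ M.ε ≡ N.ε →
               IsMorphism M N θ
  mkMorphism θ homo ε-homo = record
    { isMagmaHomomorphism = record
      { isRelHomomorphism = record { cong = cong θ }
      ; homo = homo
      }
    ; ε-homo = ε-homo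
    }

module _ {A : Set} (M : FiniteMonoid) where
  open FiniteMonoid M hiding (Carrier)

  free : (A → Carrier M) → List A → Carrier M
  free θ []      = ε
  free θ (a ∷ w) = θ a ∙ free θ w

  free-++ : ∀ θ v w → free θ (v ++ w) ≡ free θ v ∙ free θ w
  free-++ θ []      w = sym (identityˡ _)
  free-++ θ (a ∷ v) w = trans (cong (θ a ∙_) (free-++ θ v w)) (sym (assoc _ _ _))

  free-isHom : ∀ θ → IsHom M (free θ)
  free-isHom θ = record
    { isMagmaHomomorphism = record
      { isRelHomomorphism = record { cong = cong (free θ) }
      ; homo = free-++ θ
      }
    ; ε-homo = refl
    }

-- The opposite monoid exchanges R and L, so that facts about R-classes can be reused for L-classes.
op : FiniteMonoid → FiniteMonoid
op M = record { isMonoid = Flip.isMonoid isMonoid ; finite = finite }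
  where open FiniteMonoid M

trivial : FiniteMonoid
trivial = record
  { Carrier = ⊤ ; _∙_ = _ ; ε = tt
  ; isMonoid = mkIsMonoid (λ _ _ _ → refl) (λ _ → refl) (λ _ → refl)
  ; finite = finite-⊤ }

infixr 6 _⊗_
_⊗_ : FiniteMonoid → FiniteMonoid → FiniteMonoid
M ⊗ N = record
  { _∙_ = λ (a , b) (c , d) → a M.∙ c , b N.∙ d
  ; ε = M.ε , N.ε
  ; isMonoid = mkIsMonoid (λ _ _ _ → cong₂ _,_ (M.assoc _ _ _) (N.assoc _ _ _))
                          (λ _ → cong₂ _,_ (M.identityˡ _) (N.identityˡ _))
                          (λ _ → cong₂ _,_ (M.identityʳ _) (N.identityʳ _))
  ; finite = finite-× M.finite N.finite }
  where
  module M = FiniteMonoid M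
  module N = FiniteMonoid N

free-⊗ : ∀ M N (θ : A → Carrier M) (η : A → Carrier N) w →
         free (M ⊗ N) (λ a → θ a , η a) w ≡ (free M θ w , free N η w)
free-⊗ M N θ η []      = refl
free-⊗ M N θ η (a ∷ w) = cong (FiniteMonoid._∙_ (M ⊗ N) (θ a , η a)) (free-⊗ M N θ η w)

ProductClosed : Property → Set₁
ProductClosed C = C trivial × (∀ M N → C M → C N → C (M ⊗ N))

abstract
  -- The product is hidden behind the existential: what remains visible is the property `C` and that
  -- equal values in G force equal values in both factors.
  pair : {C : Property} → ProductClosed C → (M N : FiniteMonoid) → C M → C N →
         (θ : A → Carrier M) (η : A → Carrier N) →
         Σ[ G ∈ FiniteMonoid ] Σ[ ζ ∈ (A → Carrier G) ] C G ×
         (∀ v w → free G ζ v ≡ free G ζ w → free M θ v ≡ free M θ w × free N η v ≡ free N η w)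
  pair (_ , C⊗) M N CM CN θ η = M ⊗ N , (λ a → θ a , η a) , C⊗ M N CM CN , λ v w eq →
    let eq′ = trans (sym (free-⊗ M N θ η v)) (trans eq (free-⊗ M N θ η w))
    in cong proj₁ eq′ , cong proj₂ eq′

  -- Iterates `pair` along a list of indices. With a list enumerating a finite index type, the
  -- values in all the monoids `F i` are recovered from one value in G.
  joint : {C : Property} → ProductClosed C → {I : Set} (F : I → FiniteMonoid) → (∀ i → C (F i)) →
          (θ : ∀ i → A → Carrier (F i)) (is : List I) →
          Σ[ G ∈ FiniteMonoid ] Σ[ ζ ∈ (A → Carrier G) ] C G ×
          (∀ v w → free G ζ v ≡ free G ζ w → ∀ {i} → i ∈ is → free (F i) (θ i) v ≡ free (F i) (θ i) w)
  joint (C⊤ , _) F CF θ [] = trivial , _ , C⊤ , λ _ _ _ ()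
  joint {C = C} closed F CF θ (i ∷ is)
    with G , ζ , CG , sep ← joint {C = C} closed F CF θ is
    with H , ξ , CH , sep′ ← pair {C = C} closed (F i) G (CF i) CG (θ i) ζ =
    H , ξ , CH , λ v w eq → λ
      { (here refl) → proj₁ (sep′ v w eq)
      ; (there j∈)  → sep v w (proj₂ (sep′ v w eq)) j∈ }

-- Submonoids and quotients

module Submonoid (M : FiniteMonoid) {P : Carrier M → Set} (P? : ∀ m → Dec (P m))
  (P-ε : P (FiniteMonoid.ε M))
  (P-∙ : ∀ {a b} → P a → P b → P (FiniteMonoid._∙_ M a b)) where
  open FiniteMonoid M hiding (Carrier)

  -- Membership is stored as `True` of a decision, which has at most one proof. Elements are thus
  -- equal as soon as the underlying elements are, as the propositional equality of carriers
  -- requires.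
  Elem : Set
  Elem = Σ[ m ∈ Carrier M ] True (P? m)

  ≡-elem : {a b : Elem} → proj₁ a ≡ proj₁ b → a ≡ b
  ≡-elem {_ , p} {_ , q} refl = cong (_ ,_) (Bool.T-irrelevant p q)

  submonoid : FiniteMonoid
  submonoid = record
    { Carrier = Elem
    ; _∙_ = λ (a , p) (b , q) → a ∙ b , fromWitness (P-∙ (toWitness p) (toWitness q))
    ; ε = ε , fromWitness P-ε
    ; isMonoid = mkIsMonoid (λ _ _ _ → ≡-elem (assoc _ _ _)) (λ _ → ≡-elem (identityˡ _)) (λ _ → ≡-elem (identityʳ _))
    ; finite = finite-Σ finite (λ m → ⌊ P? m ⌋) }

  inclusion : IsMorphism submonoid M proj₁
  inclusion = mkMorphism submonoid M proj₁ (λ _ _ → refl) refl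

module Quotient (M : FiniteMonoid) {_≈_ : Carrier M → Carrier M → Set} (_≈?_ : ∀ a b → Dec (a ≈ b))
  (≈-refl : ∀ {a} → a ≈ a) (≈-sym : ∀ {a b} → a ≈ b → b ≈ a)
  (≈-trans : ∀ {a b c} → a ≈ b → b ≈ c → a ≈ c)
  (≈-cong : ∀ {a b c d} → a ≈ b → c ≈ d → FiniteMonoid._∙_ M a c ≈ FiniteMonoid._∙_ M b d) where
  open FiniteMonoid M hiding (Carrier)

  private
    first : List (Carrier M) → Carrier M → Carrier M
    first []       m = m
    first (a ∷ as) m = if ⌊ a ≈? m ⌋ then a else first as m

    first-≈ : ∀ as m → first as m ≈ m
    first-≈ []       m = ≈-refl
    first-≈ (a ∷ as) m with a ≈? m
    ... | yes a≈m = a≈m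
    ... | no  _   = first-≈ as m

    first-cong : ∀ {as m m′} → m ∈ as → m ≈ m′ → first as m ≡ first as m′
    first-cong {a ∷ as} {m} {m′} m∈ m≈m′ with a ≈? m | a ≈? m′ | m∈
    ... | yes _   | yes _    | _         = refl
    ... | yes a≈m | no a≉m′  | _         = contradiction (≈-trans a≈m m≈m′) a≉m′
    ... | no a≉m  | yes a≈m′ | _         = contradiction (≈-trans a≈m′ (≈-sym m≈m′)) a≉m
    ... | no a≉m  | no _     | here refl = contradiction ≈-refl a≉m
    ... | no _    | no _     | there m∈′ = first-cong m∈′ m≈m′

  -- Carriers have propositional equality, so a class is represented by its first member in the
  -- enumeration of M; related elements get literally the same representative.
  rep : Carrier M → Carrier M
  rep = first (elements finite)

  rep-≈ : ∀ m → rep m ≈ m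
  rep-≈ m = first-≈ (elements finite) m

  rep-cong : ∀ {m m′} → m ≈ m′ → rep m ≡ rep m′
  rep-cong = first-cong (∈-elements finite _)

  private
    IsRep? : ∀ m → Dec (rep m ≡ m)
    IsRep? m = finite⇒≟ finite (rep m) m

    Class′ : Set
    Class′ = Σ[ m ∈ Carrier M ] True (IsRep? m)

    ≡-class : {a b : Class′} → proj₁ a ≈ proj₁ b → a ≡ b
    ≡-class {a , p} {b , q} a≈b with refl ← trans (sym (toWitness p)) (trans (rep-cong a≈b) (toWitness q)) =
      cong (_ ,_) (Bool.T-irrelevant p q)

    class : Carrier M → Class′
    class m = rep m , fromWitness (rep-cong (rep-≈ m))

    ≈-setoid : Setoid 0ℓ 0ℓ
    ≈-setoid = record { Carrier = Carrier M ; _≈_ = _≈_ ; isEquivalence = record { refl = ≈-refl ; sym = ≈-sym ; trans = ≈-trans } }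

  open import Relation.Binary.Reasoning.Setoid ≈-setoid

  abstract
    quotient : FiniteMonoid
    quotient = record
      { Carrier = Class′
      ; _∙_ = λ (a , _) (b , _) → class (a ∙ b)
      ; ε = class ε
      ; isMonoid = mkIsMonoid
          (λ (a , _) (b , _) (c , _) → ≡-class (begin
            rep (rep (a ∙ b) ∙ c) ≈⟨ rep-≈ _ ⟩
            rep (a ∙ b) ∙ c       ≈⟨ ≈-cong (rep-≈ _) ≈-refl ⟩
            a ∙ b ∙ c             ≡⟨ assoc a b c ⟩
            a ∙ (b ∙ c)           ≈⟨ ≈-cong ≈-refl (rep-≈ _) ⟨
            a ∙ rep (b ∙ c)       ≈⟨ rep-≈ _ ⟨
            rep (a ∙ rep (b ∙ c)) ∎))
          (λ (a , _) → ≡-class (begin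
            rep (rep ε ∙ a) ≈⟨ rep-≈ _ ⟩
            rep ε ∙ a       ≈⟨ ≈-cong (rep-≈ _) ≈-refl ⟩
            ε ∙ a           ≡⟨ identityˡ a ⟩
            a               ∎))
          (λ (a , _) → ≡-class (begin
            rep (a ∙ rep ε) ≈⟨ rep-≈ _ ⟩
            a ∙ rep ε       ≈⟨ ≈-cong ≈-refl (rep-≈ _) ⟩
            a ∙ ε           ≡⟨ identityʳ a ⟩
            a               ∎))
      ; finite = finite-Σ finite (λ m → ⌊ IsRep? m ⌋) }

    [_]≈ : Carrier M → Carrier quotient
    [ m ]≈ = class m

    []≈-cong : ∀ {a b} → a ≈ b → [ a ]≈ ≡ [ b ]≈
    []≈-cong a≈b = ≡-class (≈-trans (rep-≈ _) (≈-trans a≈b (≈-sym (rep-≈ _))))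

    ≡⇒≈ : ∀ {a b} → [ a ]≈ ≡ [ b ]≈ → a ≈ b
    ≡⇒≈ eq = ≈-trans (≈-sym (rep-≈ _)) (subst (_≈ _) (sym (cong proj₁ eq)) (rep-≈ _))

    representative : Carrier quotient → Carrier M
    representative = proj₁

    [representative] : ∀ c → [ representative c ]≈ ≡ c
    [representative] c = ≡-class (rep-≈ _)

    projection : IsMorphism M quotient [_]≈
    projection = mkMorphism M quotient [_]≈
      (λ a b → ≡-class (begin
        rep (a ∙ b)             ≈⟨ rep-≈ _ ⟩
        a ∙ b                   ≈⟨ ≈-cong (rep-≈ a) (rep-≈ b) ⟨
        rep a ∙ rep b           ≈⟨ rep-≈ _ ⟨
        rep (rep a ∙ rep b)     ∎))
      refl

open ≡-Reasoning

-- Terms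

Vars : (ℕ → Set) → Term → Set
Vars Q (x i)   = Q i
Vars Q (s · t) = Vars Q s × Vars Q t
Vars Q (t ^ω)  = Vars Q t

Vars-map : ∀ {P Q : ℕ → Set} → (∀ {i} → P i → Q i) → ∀ t → Vars P t → Vars Q t
Vars-map f (x i)   p       = f p
Vars-map f (s · t) (p , q) = Vars-map f s p , Vars-map f t q
Vars-map f (t ^ω)  p       = Vars-map f t p

Vars-all : ∀ {Q : ℕ → Set} → (∀ i → Q i) → ∀ t → Vars Q t
Vars-all f (x i)   = f i
Vars-all f (s · t) = Vars-all f s , Vars-all f t
Vars-all f (t ^ω)  = Vars-all f t

-- The indices 1, ..., k, shifted by one as in `vars`.
UpTo : ℕ → ℕ → Set
UpTo k i = ∃[ j ] j < k × i ≡ suc j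

concat-∷⁺ : ∀ t ts → concat (t ∷⁺ ts) ≡ t · concat ts
concat-∷⁺ t (_ ∷ _) = refl

Vars-concat : ∀ {Q ts t} → All (Vars Q) ts → Vars Q t → Vars Q (concat (ts ++⁺ List⁺.[ t ]))
Vars-concat {ts = []}             []       q = q
Vars-concat {ts = s ∷ ts} {t = t} (p ∷ ps) q =
  subst (Vars _) (sym (concat-∷⁺ s (ts ++⁺ List⁺.[ t ]))) (p , Vars-concat ps q)

Vars-concat-∷ : ∀ {Q t ts} → Vars Q t → All (Vars Q) ts → Vars Q (concat (t ∷ ts))
Vars-concat-∷ p []       = p
Vars-concat-∷ p (q ∷ qs) = p , Vars-concat-∷ q qs

Vars-vars : ∀ {k l} → k ≤ l → All (Vars (UpTo l)) (vars k)
Vars-vars k≤l = All.map⁺ (All.tabulate (λ {j} j∈ → j , ℕ.<-≤-trans (∈-upTo⁻ j∈) k≤l , refl))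

Vars-extend : ∀ n t → Vars (UpTo (2 * n)) t → Vars (UpTo (2 * suc n)) (extend n t)
Vars-extend n t p rewrite ℕ.*-suc 2 n =
  Vars-concat (Vars-vars k≤2+k) (2 * n , ℕ.n≤1+n _ , ℕ.+-comm (2 * n) 1) ,
  Vars-map (λ (j , j<k , eq) → j , ℕ.<-≤-trans j<k k≤2+k , eq) t p ,
  Vars-concat-∷ (suc (2 * n) , ℕ.≤-refl , ℕ.+-comm (2 * n) 2) (Vars-vars k≤2+k)
  where
  k≤2+k : 2 * n ≤ 2 + 2 * n
  k≤2+k = ℕ.m≤n+m (2 * n) 2

Vars-u : ∀ n → Vars (UpTo (2 * suc n)) (u (suc n))
Vars-u zero    = (0 , s≤s z≤n , refl) , (1 , s≤s (s≤s z≤n) , refl)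
Vars-u (suc n) = Vars-extend (suc n) (u (suc n)) (Vars-u n)

Vars-v : ∀ n → Vars (UpTo (2 * suc n)) (v (suc n))
Vars-v zero    = (1 , s≤s (s≤s z≤n) , refl) , (0 , s≤s z≤n , refl)
Vars-v (suc n) = Vars-extend (suc n) (v (suc n)) (Vars-v n)

module _ (M : FiniteMonoid) where
  open FiniteMonoid M hiding (Carrier) renaming (_^ω to _^ωᴹ)

  ω-idem : ∀ m → m ^ωᴹ ∙ m ^ωᴹ ≡ m ^ωᴹ
  ω-idem m = proj₁ (proj₂ (omegaPower m))

  ω-pow : ∀ m → ∃[ k ] m ^ωᴹ ≡ pow (suc k) m
  ω-pow m = proj₂ (proj₂ (omegaPower m))

  ω-fixes-idem : ∀ {m} → m ∙ m ≡ m → m ^ωᴹ ≡ m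
  ω-fixes-idem {m} mm = omegaPower-unique (proj₂ (omegaPower m)) (mm , 0 , sym (identityʳ m))

  ∙-pow : ∀ {y m} → y ∙ m ≡ y → ∀ k → y ∙ pow k m ≡ y
  ∙-pow ym zero    = identityʳ _
  ∙-pow {y} {m} ym (suc k) = begin
    y ∙ (m ∙ pow k m) ≡⟨ assoc y m _ ⟨
    y ∙ m ∙ pow k m   ≡⟨ cong (_∙ pow k m) ym ⟩
    y ∙ pow k m       ≡⟨ ∙-pow ym k ⟩
    y                 ∎

  pow-∙ : ∀ {y m} → m ∙ y ≡ y → ∀ k → pow k m ∙ y ≡ y
  pow-∙ my zero    = identityˡ _
  pow-∙ {y} {m} my (suc k) = begin
    m ∙ pow k m ∙ y   ≡⟨ assoc m _ y ⟩
    m ∙ (pow k m ∙ y) ≡⟨ cong (m ∙_) (pow-∙ my k) ⟩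
    m ∙ y             ≡⟨ my ⟩
    y                 ∎

  ∙-ω : ∀ {y m} → y ∙ m ≡ y → y ∙ m ^ωᴹ ≡ y
  ∙-ω {y} {m} ym = trans (cong (y ∙_) (proj₂ (ω-pow m))) (∙-pow ym (suc (proj₁ (ω-pow m))))

  ω-∙ : ∀ {y m} → m ∙ y ≡ y → m ^ωᴹ ∙ y ≡ y
  ω-∙ {y} {m} my = trans (cong (_∙ y) (proj₂ (ω-pow m))) (pow-∙ my (suc (proj₁ (ω-pow m))))

  pow-shift : ∀ a b k → a ∙ pow k (b ∙ a) ≡ pow k (a ∙ b) ∙ a
  pow-shift a b zero    = trans (identityʳ a) (sym (identityˡ a))
  pow-shift a b (suc k) = begin
    a ∙ (b ∙ a ∙ pow k (b ∙ a))   ≡⟨ cong (a ∙_) (assoc b a _) ⟩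
    a ∙ (b ∙ (a ∙ pow k (b ∙ a))) ≡⟨ cong (λ z → a ∙ (b ∙ z)) (pow-shift a b k) ⟩
    a ∙ (b ∙ (pow k (a ∙ b) ∙ a)) ≡⟨ assoc a b _ ⟨
    a ∙ b ∙ (pow k (a ∙ b) ∙ a)   ≡⟨ assoc (a ∙ b) _ a ⟨
    a ∙ b ∙ pow k (a ∙ b) ∙ a     ∎

  pow-comm : ∀ k m → pow k m ∙ m ≡ m ∙ pow k m
  pow-comm k m = begin
    pow k m ∙ m       ≡⟨ cong (λ z → pow k z ∙ m) (identityʳ m) ⟨
    pow k (m ∙ ε) ∙ m ≡⟨ pow-shift m ε k ⟨
    m ∙ pow k (ε ∙ m) ≡⟨ cong (λ z → m ∙ pow k z) (identityˡ m) ⟩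
    m ∙ pow k m       ∎

  IsExponent : ℕ → Set
  IsExponent r = ∀ m → pow r m ≡ m ^ωᴹ

  private
    multiple : ∀ {m} r → pow (suc r) m ≡ m ^ωᴹ → ∀ k → pow (suc k * suc r) m ≡ m ^ωᴹ
    multiple {m} r eq k = begin
      pow (suc k * suc r) m       ≡⟨ pow-pow m (suc k) (suc r) ⟨
      pow (suc k) (pow (suc r) m) ≡⟨ cong (pow (suc k)) eq ⟩
      pow (suc k) (m ^ωᴹ)         ≡⟨ pow-idem (ω-idem m) (suc k) ⟩
      m ^ωᴹ                       ∎

    commonExponent : (ms : List (Carrier M)) → ∃[ r ] (∀ {m} → m ∈ ms → pow (suc r) m ≡ m ^ωᴹ)
    commonExponent []       = 0 , λ ()
    -- The successor of `r + k * suc r` is `suc k * suc r`, the product of an exponent for m and one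
    -- for `ms`.
    commonExponent (m ∷ ms) with r , p ← commonExponent ms | k , eq ← ω-pow m = r + k * suc r , λ
      { (here refl) → trans (cong (λ i → pow i m) (ℕ.*-comm (suc k) (suc r))) (multiple k (sym eq) r)
      ; (there m∈)  → multiple r (p m∈) k }

  abstract
    exponent : ∃[ r ] IsExponent (suc r)
    exponent with r , p ← commonExponent (elements finite) = r , λ m → p (∈-elements finite m)

  ⟦⟧-cong : ∀ {Q ρ ρ′} → (∀ {i} → Q i → ρ i ≡ ρ′ i) → ∀ t → Vars Q t → ⟦_⟧ M t ρ ≡ ⟦_⟧ M t ρ′
  ⟦⟧-cong eq (x i)   q       = eq q
  ⟦⟧-cong eq (s · t) (p , q) = cong₂ _∙_ (⟦⟧-cong eq s p) (⟦⟧-cong eq t q)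
  ⟦⟧-cong eq (t ^ω)  q       = cong _^ωᴹ (⟦⟧-cong eq t q)

  ⟦⟧-ext : ∀ {ρ ρ′} → (∀ i → ρ i ≡ ρ′ i) → ∀ t → ⟦_⟧ M t ρ ≡ ⟦_⟧ M t ρ′
  ⟦⟧-ext {ρ} {ρ′} eq t = ⟦⟧-cong {λ i → ρ i ≡ ρ′ i} id t (Vars-all eq t)

  module _ (ρ : ℕ → Carrier M) where
    product : ℕ → Carrier M
    product k = free M (ρ ∘ suc) (upTo k)

    ⟦concat⟧ : ∀ js t → ⟦_⟧ M (concat (map (x ∘ suc) js ++⁺ List⁺.[ t ])) ρ ≡ free M (ρ ∘ suc) js ∙ ⟦_⟧ M t ρ
    ⟦concat⟧ []       t = sym (identityˡ _)
    ⟦concat⟧ (j ∷ js) t = begin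
      ⟦_⟧ M (concat (x (suc j) ∷⁺ ts)) ρ                 ≡⟨ cong (λ s → ⟦_⟧ M s ρ) (concat-∷⁺ (x (suc j)) ts) ⟩
      ρ (suc j) ∙ ⟦_⟧ M (concat ts) ρ                    ≡⟨ cong (ρ (suc j) ∙_) (⟦concat⟧ js t) ⟩
      ρ (suc j) ∙ (free M (ρ ∘ suc) js ∙ ⟦_⟧ M t ρ)      ≡⟨ assoc _ _ _ ⟨
      ρ (suc j) ∙ free M (ρ ∘ suc) js ∙ ⟦_⟧ M t ρ        ∎
      where
      ts : List⁺ Term
      ts = map (x ∘ suc) js ++⁺ List⁺.[ t ]

    ⟦concat-∷⟧ : ∀ t js → ⟦_⟧ M (concat (t ∷ map (x ∘ suc) js)) ρ ≡ ⟦_⟧ M t ρ ∙ free M (ρ ∘ suc) js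
    ⟦concat-∷⟧ t []       = sym (identityʳ _)
    ⟦concat-∷⟧ t (j ∷ js) = cong (⟦_⟧ M t ρ ∙_) (⟦concat-∷⟧ (x (suc j)) js)

    ⟦extend⟧ : ∀ n t → ⟦_⟧ M (extend n t) ρ ≡
      (product (2 * n) ∙ ρ (2 * n + 1)) ^ωᴹ ∙ (⟦_⟧ M t ρ ∙ (ρ (2 * n + 2) ∙ product (2 * n)) ^ωᴹ)
    ⟦extend⟧ n t = cong₂ (λ a b → a ^ωᴹ ∙ (⟦_⟧ M t ρ ∙ b ^ωᴹ))
      (⟦concat⟧ (upTo (2 * n)) (x (2 * n + 1))) (⟦concat-∷⟧ (x (2 * n + 2)) (upTo (2 * n)))

    -- An element that fixes y on the right, or z on the left, may be replaced by its ω-power; hence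
    -- y and z swallow the two outer factors of `extend`.
    ⟦extend⟧-absorb : ∀ n {y z} → y ∙ (product (2 * n) ∙ ρ (2 * n + 1)) ≡ y → ρ (2 * n + 2) ∙ product (2 * n) ∙ z ≡ z →
      ∀ t → y ∙ ⟦_⟧ M (extend n t) ρ ∙ z ≡ y ∙ ⟦_⟧ M t ρ ∙ z
    ⟦extend⟧-absorb n {y} {z} ye fz t = trans (cong (λ m → y ∙ m ∙ z) (⟦extend⟧ n t)) (absorb (∙-ω ye) (ω-∙ fz))
      where
      absorb : ∀ {e m f} → y ∙ e ≡ y → f ∙ z ≡ z → y ∙ (e ∙ (m ∙ f)) ∙ z ≡ y ∙ m ∙ z
      absorb {e} {m} {f} ye fz = begin
        y ∙ (e ∙ (m ∙ f)) ∙ z ≡⟨ solve monoid ⟩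
        y ∙ e ∙ m ∙ (f ∙ z)   ≡⟨ cong₂ (λ p q → p ∙ m ∙ q) ye fz ⟩
        y ∙ m ∙ z             ∎

    ⟦extend⟧-cong : ∀ n {s t} → ⟦_⟧ M s ρ ≡ ⟦_⟧ M t ρ → ⟦_⟧ M (extend n s) ρ ≡ ⟦_⟧ M (extend n t) ρ
    ⟦extend⟧-cong n = cong (λ z →
      ⟦_⟧ M (concat (vars (2 * n) ++⁺ List⁺.[ x (2 * n + 1) ]) ^ω) ρ
      ∙ (z ∙ ⟦_⟧ M (concat (x (2 * n + 2) ∷ vars (2 * n)) ^ω) ρ))

module _ (M N : FiniteMonoid) {θ : Carrier M → Carrier N} (θ-hom : IsMorphism M N θ) where
  private
    module M = FiniteMonoid M
    module N = FiniteMonoid N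
  open IsMonoidHomomorphism θ-hom

  pow-morphism : ∀ k m → θ (M.pow k m) ≡ N.pow k (θ m)
  pow-morphism zero    m = ε-homo
  pow-morphism (suc k) m = trans (homo m _) (cong (θ m N.∙_) (pow-morphism k m))

  ω-morphism : ∀ m → θ (m M.^ω) ≡ θ m N.^ω
  ω-morphism m with k , eq ← ω-pow M m = N.omegaPower-unique
    ( trans (sym (homo _ _)) (cong θ (ω-idem M m))
    , k , trans (cong θ eq) (pow-morphism (suc k) m) )
    (proj₂ (N.omegaPower (θ m)))

  ⟦⟧-morphism : ∀ t ρ → θ (⟦_⟧ M t ρ) ≡ ⟦_⟧ N t (θ ∘ ρ)
  ⟦⟧-morphism (x i)   ρ = refl
  ⟦⟧-morphism (s · t) ρ = trans (homo _ _) (cong₂ N._∙_ (⟦⟧-morphism s ρ) (⟦⟧-morphism t ρ))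
  ⟦⟧-morphism (t ^ω)  ρ = trans (ω-morphism _) (cong N._^ω (⟦⟧-morphism t ρ))

module _ (M N : FiniteMonoid) where
  proj₁-morphism : IsMorphism (M ⊗ N) M proj₁
  proj₁-morphism = mkMorphism (M ⊗ N) M proj₁ (λ _ _ → refl) refl

  proj₂-morphism : IsMorphism (M ⊗ N) N proj₂
  proj₂-morphism = mkMorphism (M ⊗ N) N proj₂ (λ _ _ → refl) refl

  -- An exponent of a product serves each factor. This supplies one exponent for several monoids, so
  -- that the same word can stand for a term in all of them.
  exponent-⊗ : ∀ r → IsExponent (M ⊗ N) r → IsExponent M r × IsExponent N r
  exponent-⊗ r exp =
    (λ m → begin
      M.pow r m                           ≡⟨ pow-morphism (M ⊗ N) M proj₁-morphism r (m , N.ε) ⟨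
      proj₁ (MN.pow r (m , N.ε))          ≡⟨ cong proj₁ (exp (m , N.ε)) ⟩
      proj₁ ((m , N.ε) MN.^ω)             ≡⟨ ω-morphism (M ⊗ N) M proj₁-morphism (m , N.ε) ⟩
      m M.^ω                              ∎) ,
    (λ n → begin
      N.pow r n                           ≡⟨ pow-morphism (M ⊗ N) N proj₂-morphism r (M.ε , n) ⟨
      proj₂ (MN.pow r (M.ε , n))          ≡⟨ cong proj₂ (exp (M.ε , n)) ⟩
      proj₂ ((M.ε , n) MN.^ω)             ≡⟨ ω-morphism (M ⊗ N) N proj₂-morphism (M.ε , n) ⟩
      n N.^ω                              ∎)
    where
    module M = FiniteMonoid M
    module N = FiniteMonoid N
    module MN = FiniteMonoid (M ⊗ N)

Satisfies : Term → Term → Property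
Satisfies s t M = M ⊨ s ≈ t

⊨-productClosed : ∀ s t → ProductClosed (Satisfies s t)
⊨-productClosed s t = (λ _ → refl) , λ M N M⊨ N⊨ ρ → cong₂ _,_
  (begin
    proj₁ (⟦_⟧ (M ⊗ N) s ρ) ≡⟨ ⟦⟧-morphism (M ⊗ N) M (proj₁-morphism M N) s ρ ⟩
    ⟦_⟧ M s (proj₁ ∘ ρ)     ≡⟨ M⊨ (proj₁ ∘ ρ) ⟩
    ⟦_⟧ M t (proj₁ ∘ ρ)     ≡⟨ ⟦⟧-morphism (M ⊗ N) M (proj₁-morphism M N) t ρ ⟨
    proj₁ (⟦_⟧ (M ⊗ N) t ρ) ∎)
  (begin
    proj₂ (⟦_⟧ (M ⊗ N) s ρ) ≡⟨ ⟦⟧-morphism (M ⊗ N) N (proj₂-morphism M N) s ρ ⟩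
    ⟦_⟧ N s (proj₂ ∘ ρ)     ≡⟨ N⊨ (proj₂ ∘ ρ) ⟩
    ⟦_⟧ N t (proj₂ ∘ ρ)     ≡⟨ ⟦⟧-morphism (M ⊗ N) N (proj₂-morphism M N) t ρ ⟨
    proj₂ (⟦_⟧ (M ⊗ N) t ρ) ∎)

-- The index is shifted: `Identities n` is the condition for level n + 1, which avoids `NonZero`
-- arguments in inductions.
Identities : ℕ → Property
Identities n M = (M ⊨ u (suc n) ≈ v (suc n)) × (M ⊨ x 1 ^ω ≈ x 1 · x 1 ^ω)

Identities-productClosed : ∀ n → ProductClosed (Identities n)
Identities-productClosed n =
  (proj₁ P , proj₁ Q) , λ M N (p , q) (p′ , q′) → proj₂ P M N p p′ , proj₂ Q M N q q′
  where
  P : ProductClosed (Satisfies (u (suc n)) (v (suc n)))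
  P = ⊨-productClosed (u (suc n)) (v (suc n))
  Q : ProductClosed (Satisfies (x 1 ^ω) (x 1 · x 1 ^ω))
  Q = ⊨-productClosed (x 1 ^ω) (x 1 · x 1 ^ω)

Identities-mono : ∀ n M → Identities n M → Identities (suc n) M
Identities-mono n M (uv , ap) = (λ ρ → ⟦extend⟧-cong M ρ (suc n) {u (suc n)} {v (suc n)} (uv ρ)) , ap

-- Each level follows from the one before by substituting into `extend`. So J-trivial monoids may be
-- used as factors of K at every level.
Identities-base : ∀ n M → Identities 0 M → Identities n M
Identities-base zero    M p = p
Identities-base (suc n) M p = Identities-mono n M (Identities-base n M p)

-- J-trivial monoids and the identities of the first level

ideal-mono : ∀ M {s t} → let open FiniteMonoid M in ∀ {a b} → s ≡ a ∙ t ∙ b → ∀ {z} → ideal M s z → ideal M t z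
ideal-mono M {t = t} {a} {b} refl {z} (c , d , eq) = c ∙ a , b ∙ d , trans eq (solve monoid)
  where open FiniteMonoid M hiding (Carrier)

module JTriviality (M : FiniteMonoid) (J : JTrivial M) where
  open FiniteMonoid M hiding (Carrier) renaming (_^ω to _^ωᴹ)

  J-antisym : ∀ {s t a b c d} → s ≡ a ∙ t ∙ b → t ≡ c ∙ s ∙ d → s ≡ t
  J-antisym p q = J _ _ (ideal-mono M p , ideal-mono M q)

  R-trivial : ∀ {y} m n → y ∙ m ∙ n ≡ y → y ∙ m ≡ y
  R-trivial {y} m n eq = J-antisym {a = ε} {b = m} {c = ε} {d = n} (solve monoid) (begin
    y                ≡⟨ eq ⟨
    y ∙ m ∙ n        ≡⟨ solve monoid ⟩
    ε ∙ (y ∙ m) ∙ n  ∎)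

  L-trivial : ∀ {y} m n → n ∙ (m ∙ y) ≡ y → m ∙ y ≡ y
  L-trivial {y} m n eq = J-antisym {a = m} {b = ε} {c = n} {d = ε} (solve monoid) (begin
    y                ≡⟨ eq ⟨
    n ∙ (m ∙ y)      ≡⟨ solve monoid ⟩
    n ∙ (m ∙ y) ∙ ε  ∎)

  -- From e c (m d) = e e = e, R-triviality gives e c = e. Then e m d = e c m d = e, and
  -- R-triviality applies once more.
  idem-∙ : ∀ {e} → e ∙ e ≡ e → ∀ c m d → e ≡ c ∙ m ∙ d → e ∙ m ≡ e
  idem-∙ {e} ee c m d eq = R-trivial m d (begin
    e ∙ m ∙ d       ≡⟨ cong (λ z → z ∙ m ∙ d) e∙c ⟨
    e ∙ c ∙ m ∙ d   ≡⟨ solve monoid ⟩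
    e ∙ (c ∙ m ∙ d) ≡⟨ cong (e ∙_) eq ⟨
    e ∙ e           ≡⟨ ee ⟩
    e               ∎)
    where
    e∙c : e ∙ c ≡ e
    e∙c = R-trivial c (m ∙ d) (begin
      e ∙ c ∙ (m ∙ d) ≡⟨ solve monoid ⟩
      e ∙ (c ∙ m ∙ d) ≡⟨ cong (e ∙_) eq ⟨
      e ∙ e           ≡⟨ ee ⟩
      e               ∎)

  ∙-idem : ∀ {e} → e ∙ e ≡ e → ∀ c m d → e ≡ c ∙ m ∙ d → m ∙ e ≡ e
  ∙-idem {e} ee c m d eq = L-trivial m c (begin
    c ∙ (m ∙ e)       ≡⟨ cong (λ z → c ∙ (m ∙ z)) d∙e ⟨
    c ∙ (m ∙ (d ∙ e)) ≡⟨ solve monoid ⟩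
    c ∙ m ∙ d ∙ e     ≡⟨ cong (_∙ e) eq ⟨
    e ∙ e             ≡⟨ ee ⟩
    e                 ∎)
    where
    d∙e : d ∙ e ≡ e
    d∙e = L-trivial d (c ∙ m) (begin
      c ∙ m ∙ (d ∙ e) ≡⟨ assoc _ _ _ ⟨
      c ∙ m ∙ d ∙ e   ≡⟨ cong (_∙ e) eq ⟨
      e ∙ e           ≡⟨ ee ⟩
      e               ∎)

-- Both a and b are factors of the idempotents e = (ab)^ω and f = (ba)^ω, which therefore absorb
-- them on either side. Hence e f equals e and also f.
JTrivial⇒Identities : ∀ M → JTrivial M → Identities 0 M
JTrivial⇒Identities M J = (λ ρ → ω-swap (ρ 1) (ρ 2)) , λ ρ → sym (ω-absorbs (ρ 1))
  where
  open FiniteMonoid M hiding (Carrier) renaming (_^ω to _^ωᴹ)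
  open JTriviality M J

  ω-absorbs : ∀ m → m ∙ m ^ωᴹ ≡ m ^ωᴹ
  ω-absorbs m with k , eq ← ω-pow M m =
    ∙-idem (ω-idem M m) ε m (pow k m) (trans eq (solve monoid))

  ω-swap : ∀ a b → (a ∙ b) ^ωᴹ ≡ (b ∙ a) ^ωᴹ
  ω-swap a b with k , e≡ ← ω-pow M (a ∙ b) | l , f≡ ← ω-pow M (b ∙ a) = trans (sym ef≡e) ef≡f
    where
    e f : Carrier M
    e = (a ∙ b) ^ωᴹ
    f = (b ∙ a) ^ωᴹ

    ef≡e : e ∙ f ≡ e
    ef≡e = ∙-ω M (begin
      e ∙ (b ∙ a) ≡⟨ assoc _ _ _ ⟨
      e ∙ b ∙ a   ≡⟨ cong (_∙ a) (idem-∙ (ω-idem M _) a b (pow k (a ∙ b)) e≡) ⟩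
      e ∙ a       ≡⟨ idem-∙ (ω-idem M _) ε a (b ∙ pow k (a ∙ b)) (trans e≡ (solve monoid)) ⟩
      e           ∎)

    ef≡f : e ∙ f ≡ f
    ef≡f = ω-∙ M (begin
      a ∙ b ∙ f   ≡⟨ assoc _ _ _ ⟩
      a ∙ (b ∙ f) ≡⟨ cong (a ∙_) (∙-idem (ω-idem M _) ε b (a ∙ pow l (b ∙ a)) (trans f≡ (solve monoid))) ⟩
      a ∙ f       ≡⟨ ∙-idem (ω-idem M _) b a (pow l (b ∙ a)) f≡ ⟩
      f           ∎)

module _ (M : FiniteMonoid) where
  open FiniteMonoid M hiding (Carrier) renaming (_^ω to _^ωᴹ)

  private
    sandwich-pow : ∀ {s} p q → s ≡ p ∙ s ∙ q → ∀ k → s ≡ pow k p ∙ s ∙ pow k q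
    sandwich-pow p q eq zero    = sym (trans (identityʳ _) (identityˡ _))
    sandwich-pow {s} p q eq (suc k) = begin
      s                                     ≡⟨ sandwich-pow p q eq k ⟩
      pow k p ∙ s ∙ pow k q                 ≡⟨ cong (λ z → pow k p ∙ z ∙ pow k q) eq ⟩
      pow k p ∙ (p ∙ s ∙ q) ∙ pow k q       ≡⟨ solve monoid ⟩
      (pow k p ∙ p) ∙ s ∙ (q ∙ pow k q)     ≡⟨ cong (λ z → z ∙ s ∙ (q ∙ pow k q)) (pow-comm M k p) ⟩
      (p ∙ pow k p) ∙ s ∙ (q ∙ pow k q)     ∎

  -- Write s = a t b and t = c s d. Iterating s = (ac) s (db) gives s = e s f with e = (ac)^ω =
  -- (ca)^ω and f = (db)^ω. The identities yield c e = e and f d = f, so t = c e s f d = e s f = s.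
  Identities⇒JTrivial : Identities 0 M → JTrivial M
  Identities⇒JTrivial (uv , ap) s t (s⊆t , t⊆s)
    with a , b , s≡ ← s⊆t (ε , ε , sym (trans (identityʳ _) (identityˡ s)))
       | c , d , t≡ ← t⊆s (ε , ε , sym (trans (identityʳ _) (identityˡ t))) = sym (begin
    t                     ≡⟨ t≡ ⟩
    c ∙ s ∙ d             ≡⟨ cong (λ z → c ∙ z ∙ d) s≡esf ⟩
    c ∙ (e ∙ s ∙ f) ∙ d   ≡⟨ solve monoid ⟩
    (c ∙ e) ∙ s ∙ (f ∙ d) ≡⟨ cong₂ (λ y z → y ∙ s ∙ z) c∙e f∙d ⟩
    e ∙ s ∙ f             ≡⟨ s≡esf ⟨
    s                     ∎)
    where
    r : ℕ
    r = suc (proj₁ (exponent M))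

    pow-ω : ∀ m → pow r m ≡ m ^ωᴹ
    pow-ω = proj₂ (exponent M)

    ω-swap : ∀ a b → (a ∙ b) ^ωᴹ ≡ (b ∙ a) ^ωᴹ
    ω-swap a b = uv (λ { 1 → a ; _ → b })

    ω-absorbs : ∀ m → m ∙ m ^ωᴹ ≡ m ^ωᴹ
    ω-absorbs m = sym (ap (λ _ → m))

    commutes : ∀ a b → a ∙ (a ∙ b) ^ωᴹ ≡ (a ∙ b) ^ωᴹ ∙ a
    commutes a b = begin
      a ∙ (a ∙ b) ^ωᴹ   ≡⟨ cong (a ∙_) (ω-swap a b) ⟩
      a ∙ (b ∙ a) ^ωᴹ   ≡⟨ cong (a ∙_) (pow-ω _) ⟨
      a ∙ pow r (b ∙ a) ≡⟨ pow-shift M a b r ⟩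
      pow r (a ∙ b) ∙ a ≡⟨ cong (_∙ a) (pow-ω _) ⟩
      (a ∙ b) ^ωᴹ ∙ a   ∎

    -- (ca)^ω is fixed by ca and commutes with both letters, so it equals c^k (ca)^ω a^k for every k.
    ω-absorbs-left : ∀ c a → c ∙ (c ∙ a) ^ωᴹ ≡ (c ∙ a) ^ωᴹ
    ω-absorbs-left c a = begin
      c ∙ g                         ≡⟨ cong (c ∙_) (split r) ⟩
      c ∙ (pow r c ∙ g ∙ pow r a)   ≡⟨ cong (λ z → c ∙ (z ∙ g ∙ pow r a)) (pow-ω c) ⟩
      c ∙ (c ^ωᴹ ∙ g ∙ pow r a)     ≡⟨ regroup c (c ^ωᴹ) g (pow r a) ⟩
      c ∙ c ^ωᴹ ∙ g ∙ pow r a       ≡⟨ cong (λ z → z ∙ g ∙ pow r a) (trans (ω-absorbs c) (sym (pow-ω c))) ⟩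
      pow r c ∙ g ∙ pow r a         ≡⟨ split r ⟨
      g                             ∎
      where
      g : Carrier M
      g = (c ∙ a) ^ωᴹ

      regroup : ∀ p q y z → p ∙ (q ∙ y ∙ z) ≡ p ∙ q ∙ y ∙ z
      regroup p q y z = solve monoid

      c∙g∙a : g ≡ c ∙ g ∙ a
      c∙g∙a = begin
        g             ≡⟨ ω-absorbs (c ∙ a) ⟨
        c ∙ a ∙ g     ≡⟨ assoc c a g ⟩
        c ∙ (a ∙ g)   ≡⟨ cong (λ z → c ∙ (a ∙ z)) (ω-swap c a) ⟩
        c ∙ (a ∙ (a ∙ c) ^ωᴹ) ≡⟨ cong (c ∙_) (commutes a c) ⟩
        c ∙ ((a ∙ c) ^ωᴹ ∙ a) ≡⟨ cong (λ z → c ∙ (z ∙ a)) (ω-swap a c) ⟩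
        c ∙ (g ∙ a)   ≡⟨ assoc c g a ⟨
        c ∙ g ∙ a     ∎

      split : ∀ k → g ≡ pow k c ∙ g ∙ pow k a
      split = sandwich-pow c a c∙g∙a

    e f : Carrier M
    e = (c ∙ a) ^ωᴹ
    f = (d ∙ b) ^ωᴹ

    c∙e : c ∙ e ≡ e
    c∙e = ω-absorbs-left c a

    f∙d : f ∙ d ≡ f
    f∙d = trans (sym (commutes d b)) (ω-absorbs-left d b)

    s≡esf : s ≡ e ∙ s ∙ f
    s≡esf = begin
      s                                   ≡⟨ sandwich-pow (a ∙ c) (d ∙ b) s≡acsdb r ⟩
      pow r (a ∙ c) ∙ s ∙ pow r (d ∙ b)   ≡⟨ cong₂ (λ y z → y ∙ s ∙ z) (trans (pow-ω _) (ω-swap a c)) (pow-ω _) ⟩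
      e ∙ s ∙ f                           ∎
      where
      s≡acsdb : s ≡ a ∙ c ∙ s ∙ (d ∙ b)
      s≡acsdb = begin
        s                       ≡⟨ s≡ ⟩
        a ∙ t ∙ b               ≡⟨ cong (λ z → a ∙ z ∙ b) t≡ ⟩
        a ∙ (c ∙ s ∙ d) ∙ b     ≡⟨ solve monoid ⟩
        a ∙ c ∙ s ∙ (d ∙ b)     ∎

-- Contexts of letters under τ

-- The local function of τ is not in scope; unification names it here.
mutual
  τ-go : {A N : Set} → (List A → N) → List A → List A → List (N × A × N)
  τ-go = _

  τ-∷ : {A N : Set} (ψ : List A → N) (a : A) (w : List A) →
        τ ψ (a ∷ w) ≡ (ψ [] , a , ψ w) ∷ τ-go ψ [ a ] w
  -- Abstracting `[ a ]` leaves `τ-go` applied to variables only, which determines it.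
  τ-∷ ψ a w with [ a ]
  ... | _ = refl

module Contexts {A : Set} (N : FiniteMonoid) (ψ : List A → Carrier N) (ψ-hom : IsHom N ψ) where
  open FiniteMonoid N hiding (Carrier)
  open IsMonoidHomomorphism ψ-hom using (homo; ε-homo)

  -- τ of a factor that stands after a prefix of value e and before a suffix of value f. Since the
  -- surroundings enter only through their values, concatenations can be cut into pieces.
  contexts : Carrier N → List A → Carrier N → List (Carrier N × A × Carrier N)
  contexts e []      f = []
  contexts e (a ∷ w) f = (e , a , ψ w ∙ f) ∷ contexts (e ∙ ψ [ a ]) w f

  τ≡contexts : ∀ w → τ ψ w ≡ contexts ε w ε
  τ≡contexts w = trans (τ-go≡contexts [] w) (cong (λ e → contexts e w ε) ε-homo)
    where
    τ-go≡contexts : ∀ p w → τ-go ψ p w ≡ contexts (ψ p) w ε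
    τ-go≡contexts p []      = refl
    τ-go≡contexts p (a ∷ w) = cong₂ _∷_ (cong (λ f → ψ p , a , f) (sym (identityʳ _))) (begin
      τ-go ψ (p ++ [ a ]) w        ≡⟨ τ-go≡contexts (p ++ [ a ]) w ⟩
      contexts (ψ (p ++ [ a ])) w ε ≡⟨ cong (λ e → contexts e w ε) (homo p [ a ]) ⟩
      contexts (ψ p ∙ ψ [ a ]) w ε ∎)

  contexts-++ : ∀ e v w f → contexts e (v ++ w) f ≡ contexts e v (ψ w ∙ f) ++ contexts (e ∙ ψ v) w f
  contexts-++ e []      w f = cong (λ e → contexts e w f) (sym (trans (cong (e ∙_) ε-homo) (identityʳ e)))
  contexts-++ e (a ∷ v) w f = cong₂ _∷_
    (cong (λ f → e , a , f) (trans (cong (_∙ f) (homo v w)) (assoc _ _ _)))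
    (begin
      contexts (e ∙ ψ [ a ]) (v ++ w) f
        ≡⟨ contexts-++ (e ∙ ψ [ a ]) v w f ⟩
      contexts (e ∙ ψ [ a ]) v (ψ w ∙ f) ++ contexts (e ∙ ψ [ a ] ∙ ψ v) w f
        ≡⟨ cong (λ g → contexts (e ∙ ψ [ a ]) v (ψ w ∙ f) ++ contexts g w f) (trans (assoc _ _ _) (cong (e ∙_) (sym (homo [ a ] v)))) ⟩
      contexts (e ∙ ψ [ a ]) v (ψ w ∙ f) ++ contexts (e ∙ ψ (a ∷ v)) w f ∎)

  -- Take pairs of a prefix value and a suffix value as vertices and letters as edges: these letters
  -- are the loops at (e , f).
  Loop : Carrier N → Carrier N → A → Set
  Loop e f a = e ∙ ψ [ a ] ≡ e × ψ [ a ] ∙ f ≡ f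

  module _ {e f : Carrier N} where
    loops-left : ∀ {w} → All (Loop e f) w → e ∙ ψ w ≡ e
    loops-left []                  = trans (cong (e ∙_) ε-homo) (identityʳ e)
    loops-left {a ∷ w} ((ea , _) ∷ p) = begin
      e ∙ ψ (a ∷ w)       ≡⟨ cong (e ∙_) (homo [ a ] w) ⟩
      e ∙ (ψ [ a ] ∙ ψ w) ≡⟨ assoc _ _ _ ⟨
      e ∙ ψ [ a ] ∙ ψ w   ≡⟨ cong (_∙ ψ w) ea ⟩
      e ∙ ψ w             ≡⟨ loops-left p ⟩
      e                   ∎

    loops-right : ∀ {w} → All (Loop e f) w → ψ w ∙ f ≡ f
    loops-right []                  = trans (cong (_∙ f) ε-homo) (identityˡ f)
    loops-right {a ∷ w} ((_ , af) ∷ p) = begin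
      ψ (a ∷ w) ∙ f       ≡⟨ cong (_∙ f) (homo [ a ] w) ⟩
      ψ [ a ] ∙ ψ w ∙ f   ≡⟨ assoc _ _ _ ⟩
      ψ [ a ] ∙ (ψ w ∙ f) ≡⟨ cong (ψ [ a ] ∙_) (loops-right p) ⟩
      ψ [ a ] ∙ f         ≡⟨ af ⟩
      f                   ∎

    contexts-loops : ∀ {w} → All (Loop e f) w → contexts e w f ≡ map (λ a → e , a , f) w
    contexts-loops []       = refl
    contexts-loops {a ∷ w} ((ea , _) ∷ p) = cong₂ _∷_
      (cong (λ g → e , a , g) (loops-right p))
      (trans (cong (λ e → contexts e w f) ea) (contexts-loops p))

  module _ (E F : List A) {w : List A} (loops : All (Loop (ψ E) (ψ F)) w) where
    ψ-sandwich : ψ (E ++ (w ++ F)) ≡ ψ E ∙ ψ F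
    ψ-sandwich = begin
      ψ (E ++ (w ++ F))   ≡⟨ homo E (w ++ F) ⟩
      ψ E ∙ ψ (w ++ F)    ≡⟨ cong (ψ E ∙_) (trans (homo w F) (loops-right loops)) ⟩
      ψ E ∙ ψ F           ∎

    -- Absorbed by `ψ E` on one side and by `ψ F` on the other, the loops alter no context outside
    -- w, and within w they all see the same one. Only the middle part depends on w.
    τ-sandwich : τ ψ (E ++ (w ++ F)) ≡
      contexts ε E (ψ F) ++ (map (λ a → ψ E , a , ψ F) w ++ contexts (ψ E) F ε)
    τ-sandwich = begin
      τ ψ (E ++ (w ++ F))
        ≡⟨ τ≡contexts _ ⟩
      contexts ε (E ++ (w ++ F)) ε
        ≡⟨ contexts-++ ε E (w ++ F) ε ⟩
      contexts ε E (ψ (w ++ F) ∙ ε) ++ contexts (ε ∙ ψ E) (w ++ F) ε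
        ≡⟨ cong₂ (λ f e → contexts ε E f ++ contexts e (w ++ F) ε)
             (trans (identityʳ _) (trans (homo w F) (loops-right loops))) (identityˡ _) ⟩
      contexts ε E (ψ F) ++ contexts (ψ E) (w ++ F) ε
        ≡⟨ cong (contexts ε E (ψ F) ++_) (contexts-++ (ψ E) w F ε) ⟩
      contexts ε E (ψ F) ++ (contexts (ψ E) w (ψ F ∙ ε) ++ contexts (ψ E ∙ ψ w) F ε)
        ≡⟨ cong₂ (λ f e → contexts ε E (ψ F) ++ (contexts (ψ E) w f ++ contexts e F ε))
             (identityʳ _) (loops-left loops) ⟩
      contexts ε E (ψ F) ++ (contexts (ψ E) w (ψ F) ++ contexts (ψ E) F ε)
        ≡⟨ cong (λ l → contexts ε E (ψ F) ++ (l ++ contexts (ψ E) F ε)) (contexts-loops loops) ⟩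
      contexts ε E (ψ F) ++ (map (λ a → ψ E , a , ψ F) w ++ contexts (ψ E) F ε) ∎

repeat : {A : Set} → ℕ → List A → List A
repeat zero    w = []
repeat (suc k) w = w ++ repeat k w

-- For an exponent r common to finitely many monoids, t^ω may be read as the word t^r.
module _ {A : Set} (r : ℕ) (σ : ℕ → List A) where
  expand : Term → List A
  expand (x i)   = σ i
  expand (s · t) = expand s ++ expand t
  expand (t ^ω)  = repeat r (expand t)

  module _ {P : A → Set} where
    All-repeat : ∀ k {w} → All P w → All P (repeat k w)
    All-repeat zero    p = []
    All-repeat (suc k) p = All.++⁺ p (All-repeat k p)

    All-expand : ∀ {Q} → (∀ {i} → Q i → All P (σ i)) → ∀ t → Vars Q t → All P (expand t)
    All-expand P-σ (x i)   q       = P-σ q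
    All-expand P-σ (s · t) (p , q) = All.++⁺ (All-expand P-σ s p) (All-expand P-σ t q)
    All-expand P-σ (t ^ω)  q       = All-repeat r (All-expand P-σ t q)

  module _ (M : FiniteMonoid) {φ : List A → Carrier M} (φ-hom : IsHom M φ) (exp : IsExponent M r) where
    open FiniteMonoid M hiding (Carrier)
    open IsMonoidHomomorphism φ-hom using (homo; ε-homo)

    repeat-hom : ∀ k w → φ (repeat k w) ≡ pow k (φ w)
    repeat-hom zero    w = ε-homo
    repeat-hom (suc k) w = trans (homo w _) (cong (φ w ∙_) (repeat-hom k w))

    expand-hom : ∀ t → φ (expand t) ≡ ⟦_⟧ M t (φ ∘ σ)
    expand-hom (x i)   = refl
    expand-hom (s · t) = trans (homo _ _) (cong₂ _∙_ (expand-hom s) (expand-hom t))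
    expand-hom (t ^ω)  = begin
      φ (repeat r (expand t)) ≡⟨ repeat-hom r (expand t) ⟩
      pow r (φ (expand t))    ≡⟨ exp _ ⟩
      _                       ≡⟨ cong (FiniteMonoid._^ω M) (expand-hom t) ⟩
      _                       ∎

-- From a factorisation with J-trivial N to the identities

module _ (M : FiniteMonoid) where
  open FiniteMonoid M hiding (Carrier) renaming (_^ω to _^ωᴹ)

  ideal-∙ˡ : ∀ {m y} z → ideal M m y → ideal M m (y ∙ z)
  ideal-∙ˡ {m} z (c , d , refl) = c , d ∙ z , solve monoid

  ideal-∙ʳ : ∀ {m y} z → ideal M m y → ideal M m (z ∙ y)
  ideal-∙ʳ {m} z (c , d , refl) = z ∙ c , d , solve monoid

  ideal-ω : ∀ {m y} → ideal M m y → ideal M m (y ^ωᴹ)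
  ideal-ω {y = y} i with k , eq ← ω-pow M y = subst (ideal M _) (sym eq) (ideal-∙ˡ (pow k y) i)

  ideal-free : ∀ {A : Set} (θ : A → Carrier M) {w a} → a ∈ w → ideal M (θ a) (free M θ w)
  ideal-free θ {_ ∷ w} (here refl) = ε , free M θ w , cong (_∙ free M θ w) (sym (identityˡ _))
  ideal-free θ {a ∷ w} (there a∈w) = ideal-∙ʳ (θ a) (ideal-free θ a∈w)

  ideal-hom : ∀ {A : Set} {φ : List A → Carrier M} → IsHom M φ → ∀ {w a} → a ∈ w → ideal M (φ [ a ]) (φ w)
  ideal-hom {φ = φ} φ-hom {_ ∷ w} (here refl) = ε , _ , trans (homo _ w) (cong (_∙ φ w) (sym (identityˡ _)))
    where open IsMonoidHomomorphism φ-hom using (homo)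
  ideal-hom φ-hom {b ∷ w} (there a∈w) = subst (ideal M _) (sym (homo [ b ] w)) (ideal-∙ʳ _ (ideal-hom φ-hom a∈w))
    where open IsMonoidHomomorphism φ-hom using (homo)

module _ {A : Set} (M N K : FiniteMonoid)
  {φ : List A → Carrier M} {ψ : List A → Carrier N} {h : List (Carrier N × A × Carrier N) → Carrier K}
  (φ-hom : IsHom M φ) (φ-surj : Surjective _≡_ _≡_ φ) (ψ-hom : IsHom N ψ) (h-hom : IsHom K h)
  (factors : ∀ v w → ψ v ≡ ψ w → h (τ ψ v) ≡ h (τ ψ w) → φ v ≡ φ w)
  (N-J : JTrivial N) where

  private
    module N = FiniteMonoid N
    module M = FiniteMonoid M
    module K = FiniteMonoid K
    module h = IsMonoidHomomorphism h-hom
    module φ = IsMonoidHomomorphism φ-hom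
  open Contexts N ψ ψ-hom
  open JTriviality N N-J

  private
    r : ℕ
    r = suc (proj₁ (exponent (M ⊗ (N ⊗ K))))

    exp-M : IsExponent M r
    exp-M = proj₁ (exponent-⊗ M (N ⊗ K) r (proj₂ (exponent (M ⊗ (N ⊗ K)))))

    exp-N⊗K : IsExponent (N ⊗ K) r
    exp-N⊗K = proj₂ (exponent-⊗ M (N ⊗ K) r (proj₂ (exponent (M ⊗ (N ⊗ K)))))

    exp-N : IsExponent N r
    exp-N = proj₁ (exponent-⊗ N K r exp-N⊗K)

    exp-K : IsExponent K r
    exp-K = proj₂ (exponent-⊗ N K r exp-N⊗K)

    -- In a constant context, K evaluates plain words over A, and identities of K become applicable
    -- to them.
    constant-context-hom : ∀ e f → IsHom K (h ∘ map (λ a → e , a , f))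
    constant-context-hom e f = record
      { isMagmaHomomorphism = record
        { isRelHomomorphism = record { cong = cong _ }
        ; homo = λ v w → trans (cong h (List.map-++ _ v w)) (h.homo _ _) }
      ; ε-homo = h.ε-homo }

    φ-sandwich : ∀ E F {v w} → All (Loop (ψ E) (ψ F)) v → All (Loop (ψ E) (ψ F)) w →
      h (map (λ a → ψ E , a , ψ F) v) ≡ h (map (λ a → ψ E , a , ψ F) w) →
      φ (E ++ (v ++ F)) ≡ φ (E ++ (w ++ F))
    φ-sandwich E F {v} {w} v-loops w-loops eq = factors _ _
      (trans (ψ-sandwich E F v-loops) (sym (ψ-sandwich E F w-loops)))
      (begin
        h (τ ψ (E ++ (v ++ F))) ≡⟨ h-τ v-loops ⟩
        _                       ≡⟨ cong (λ z → h (contexts N.ε E (ψ F)) K.∙ (z K.∙ h (contexts (ψ E) F N.ε))) eq ⟩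
        _                       ≡⟨ h-τ w-loops ⟨
        h (τ ψ (E ++ (w ++ F))) ∎)
      where
      h-τ : ∀ {w} → All (Loop (ψ E) (ψ F)) w → h (τ ψ (E ++ (w ++ F))) ≡
        h (contexts N.ε E (ψ F)) K.∙ (h (map (λ a → ψ E , a , ψ F) w) K.∙ h (contexts (ψ E) F N.ε))
      h-τ loops = trans (cong h (τ-sandwich E F loops)) (trans (h.homo _ _) (cong (h (contexts N.ε E (ψ F)) K.∙_) (h.homo _ _)))

    idem-loop : ∀ {e f a} → e N.∙ e ≡ e → f N.∙ f ≡ f →
                ideal N (ψ [ a ]) e → ideal N (ψ [ a ]) f → Loop e f a
    idem-loop ee ff (b , c , e≡) (d , g , f≡) = idem-∙ ee b _ c e≡ , ∙-idem ff d _ g f≡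

    ψ-ω : ∀ σ t → ψ (expand r σ (t ^ω)) ≡ (⟦_⟧ N t (ψ ∘ σ)) N.^ω
    ψ-ω σ t = expand-hom r σ N ψ-hom exp-N (t ^ω)

    preimage : (ρ : ℕ → Carrier M) → ℕ → List A
    preimage ρ i = proj₁ (φ-surj (ρ i))

    φ-preimage : ∀ ρ i → φ (preimage ρ i) ≡ ρ i
    φ-preimage ρ i = proj₂ (φ-surj (ρ i)) refl

    φ-expand : ∀ ρ t → φ (expand r (preimage ρ) t) ≡ ⟦_⟧ M t ρ
    φ-expand ρ t = trans (expand-hom r (preimage ρ) M φ-hom exp-M t) (⟦⟧-ext M (φ-preimage ρ) t)

  -- The outer ω-powers of `extend n` expand to E and F, whose images in N are idempotents with
  -- every letter substituted for x₁, ..., x₂ₙ as a factor. These letters are loops at (`ψ E` ,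
  -- `ψ F`), so s and t are compared by K in a constant context.
  extend-satisfied : ∀ n {s t} → Vars (UpTo (2 * n)) s → Vars (UpTo (2 * n)) t →
                     K ⊨ s ≈ t → M ⊨ extend n s ≈ extend n t
  extend-satisfied n {s} {t} s-vars t-vars K⊨ ρ = begin
    ⟦_⟧ M (extend n s) ρ      ≡⟨ φ-expand ρ (extend n s) ⟨
    φ (expand r σ (extend n s)) ≡⟨ φ-sandwich E F (All-expand r σ loops s s-vars) (All-expand r σ loops t t-vars) h-eq ⟩
    φ (expand r σ (extend n t)) ≡⟨ φ-expand ρ (extend n t) ⟩
    ⟦_⟧ M (extend n t) ρ      ∎
    where
    σ : ℕ → List A
    σ = preimage ρ

    Eᵗ Fᵗ : Term
    Eᵗ = concat (vars (2 * n) ++⁺ List⁺.[ x (2 * n + 1) ])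
    Fᵗ = concat (x (2 * n + 2) ∷ vars (2 * n))

    E F : List A
    E = expand r σ (Eᵗ ^ω)
    F = expand r σ (Fᵗ ^ω)

    idem : ∀ t → ψ (expand r σ (t ^ω)) N.∙ ψ (expand r σ (t ^ω)) ≡ ψ (expand r σ (t ^ω))
    idem t = subst (λ e → e N.∙ e ≡ e) (sym (ψ-ω σ t)) (ω-idem N _)

    product-in-ideal : ∀ {i a} → UpTo (2 * n) i → a ∈ σ i → ideal N (ψ [ a ]) (product N (ψ ∘ σ) (2 * n))
    product-in-ideal (j , j< , refl) a∈ with c , d , eq ← ideal-free N (ψ ∘ σ ∘ suc) (∈-upTo⁺ j<) =
      subst (ideal N _) (sym eq) (ideal-∙ˡ N d (ideal-∙ʳ N c (ideal-hom N ψ-hom a∈)))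

    loops : ∀ {i} → UpTo (2 * n) i → All (Loop (ψ E) (ψ F)) (σ i)
    loops i≤ = All.tabulate λ a∈ → idem-loop (idem Eᵗ) (idem Fᵗ)
      (subst (ideal N _) (sym (ψ-ω σ Eᵗ)) (ideal-ω N
        (subst (ideal N _) (sym (⟦concat⟧ N (ψ ∘ σ) (upTo (2 * n)) _)) (ideal-∙ˡ N _ (product-in-ideal i≤ a∈)))))
      (subst (ideal N _) (sym (ψ-ω σ Fᵗ)) (ideal-ω N
        (subst (ideal N _) (sym (⟦concat-∷⟧ N (ψ ∘ σ) _ (upTo (2 * n)))) (ideal-∙ʳ N _ (product-in-ideal i≤ a∈)))))

    h-eq : h (map (λ a → ψ E , a , ψ F) (expand r σ s)) ≡ h (map (λ a → ψ E , a , ψ F) (expand r σ t))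
    h-eq = trans (h-expand s) (trans (K⊨ (h ∘ map (λ a → ψ E , a , ψ F) ∘ σ)) (sym (h-expand t)))
      where
      h-expand : ∀ t → h (map (λ a → ψ E , a , ψ F) (expand r σ t)) ≡
                       ⟦_⟧ K t (h ∘ map (λ a → ψ E , a , ψ F) ∘ σ)
      h-expand = expand-hom r σ K (constant-context-hom (ψ E) (ψ F)) exp-K

  -- Here e = m^ω, where m is the value of x₁, plays both outer roles. The identity of K gives e e e
  -- = e (m e) e, and as e commutes with m this reduces to e = m e.
  aperiodicity-satisfied : K ⊨ x 1 ^ω ≈ x 1 · x 1 ^ω → M ⊨ x 1 ^ω ≈ x 1 · x 1 ^ω
  aperiodicity-satisfied K⊨ ρ = begin
    e                                 ≡⟨ trans (cong (e M.∙_) ee) ee ⟨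
    e M.∙ (e M.∙ e)                   ≡⟨ sym (φ-EtE (x 1 ^ω)) ⟩
    φ (E ++ (expand r σ (x 1 ^ω) ++ E))       ≡⟨ φ-sandwich E E (All-expand r σ loops (x 1 ^ω) refl)
                                           (All-expand r σ loops (x 1 · x 1 ^ω) (refl , refl)) h-eq ⟩
    φ (E ++ (expand r σ (x 1 · x 1 ^ω) ++ E)) ≡⟨ φ-EtE (x 1 · x 1 ^ω) ⟩
    e M.∙ (ρ 1 M.∙ e M.∙ e)           ≡⟨ cong (e M.∙_) (trans (M.assoc _ _ _) (cong (ρ 1 M.∙_) ee)) ⟩
    e M.∙ (ρ 1 M.∙ e)                 ≡⟨ M.assoc _ _ _ ⟨
    e M.∙ ρ 1 M.∙ e                   ≡⟨ cong (M._∙ e) e-comm ⟩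
    ρ 1 M.∙ e M.∙ e                   ≡⟨ trans (M.assoc _ _ _) (cong (ρ 1 M.∙_) ee) ⟩
    ρ 1 M.∙ e                         ∎
    where
    σ : ℕ → List A
    σ = preimage ρ

    E : List A
    E = expand r σ (x 1 ^ω)

    e : Carrier M
    e = ρ 1 M.^ω

    ee : e M.∙ e ≡ e
    ee = ω-idem M (ρ 1)

    e-comm : e M.∙ ρ 1 ≡ ρ 1 M.∙ e
    e-comm = subst (λ z → z M.∙ ρ 1 ≡ ρ 1 M.∙ z) (exp-M (ρ 1)) (pow-comm M r (ρ 1))

    φ-EtE : ∀ t → φ (E ++ (expand r σ t ++ E)) ≡ e M.∙ (⟦_⟧ M t ρ M.∙ e)
    φ-EtE t = begin
      φ (E ++ (expand r σ t ++ E))             ≡⟨ φ.homo _ _ ⟩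
      φ E M.∙ φ (expand r σ t ++ E)            ≡⟨ cong (φ E M.∙_) (φ.homo _ _) ⟩
      φ E M.∙ (φ (expand r σ t) M.∙ φ E)       ≡⟨ cong₂ (λ y z → y M.∙ (z M.∙ y)) (φ-expand ρ (x 1 ^ω)) (φ-expand ρ t) ⟩
      e M.∙ (⟦_⟧ M t ρ M.∙ e)                  ∎

    idem : ψ E N.∙ ψ E ≡ ψ E
    idem = subst (λ e → e N.∙ e ≡ e) (sym (ψ-ω σ (x 1))) (ω-idem N _)

    loops : ∀ {i} → i ≡ 1 → All (Loop (ψ E) (ψ E)) (σ i)
    loops refl = All.tabulate λ a∈ →
      let i = subst (ideal N _) (sym (ψ-ω σ (x 1))) (ideal-ω N (ideal-hom N ψ-hom a∈))
      in idem-loop idem idem i i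

    h-eq : h (map (λ a → ψ E , a , ψ E) (expand r σ (x 1 ^ω))) ≡ h (map (λ a → ψ E , a , ψ E) (expand r σ (x 1 · x 1 ^ω)))
    h-eq = trans (h-expand (x 1 ^ω)) (trans (K⊨ (h ∘ map (λ a → ψ E , a , ψ E) ∘ σ)) (sym (h-expand (x 1 · x 1 ^ω))))
      where
      h-expand : ∀ t → h (map (λ a → ψ E , a , ψ E) (expand r σ t)) ≡
                       ⟦_⟧ K t (h ∘ map (λ a → ψ E , a , ψ E) ∘ σ)
      h-expand = expand-hom r σ K (constant-context-hom (ψ E) (ψ E)) exp-K

  product-satisfies : ∀ n → Identities n K → Identities (suc n) M
  product-satisfies n (uv , ap) =
    extend-satisfied (suc n) {u (suc n)} {v (suc n)} (Vars-u n) (Vars-v n) uv , aperiodicity-satisfied ap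

-- Stabilisers of R-classes and L-classes

-- The condition y m R y; over `op M` it reads m y L y.
Stab : (M : FiniteMonoid) → Carrier M → Carrier M → Set
Stab M y m = ∃[ t ] y ∙ m ∙ t ≡ y
  where open FiniteMonoid M hiding (Carrier)

Stab? : ∀ M y m → Dec (Stab M y m)
Stab? M y m = any-finite? finite (λ t → finite⇒≟ finite (y ∙ m ∙ t) y)
  where open FiniteMonoid M hiding (Carrier)

FactorsStabilise : Property
FactorsStabilise M = ∀ {h} c m d → h ∙ h ≡ h → h ≡ c ∙ m ∙ d → Stab M h m
  where open FiniteMonoid M hiding (Carrier)

module Stabilisers (M : FiniteMonoid) (stable : FactorsStabilise M) where
  open FiniteMonoid M hiding (Carrier) renaming (_^ω to _^ωᴹ)

  private
    stab-idem : ∀ {y h} c m d → h ∙ h ≡ h → h ≡ c ∙ m ∙ d → y ∙ h ≡ y → Stab M y m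
    stab-idem {y} {h} c m d hh h≡ yh with t , hmt ← stable c m d hh h≡ = t , (begin
      y ∙ m ∙ t       ≡⟨ cong (λ z → z ∙ m ∙ t) yh ⟨
      y ∙ h ∙ m ∙ t   ≡⟨ solve monoid ⟩
      y ∙ (h ∙ m ∙ t) ≡⟨ cong (y ∙_) hmt ⟩
      y ∙ h           ≡⟨ yh ⟩
      y               ∎)

  abstract
    -- Along with c m d, its ω-power fixes y. That power is an idempotent with m as a factor, so
    -- `stable` applies to it.
    stab-factor : ∀ {y} c m d → y ∙ (c ∙ m ∙ d) ≡ y → Stab M y m
    stab-factor c m d yz =
      stab-idem c m (d ∙ pow (proj₁ k,ω≡) (c ∙ m ∙ d)) (ω-idem M (c ∙ m ∙ d)) (trans (proj₂ k,ω≡) (assoc _ _ _)) (∙-ω M yz)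
      where
      k,ω≡ : ∃[ k ] (c ∙ m ∙ d) ^ωᴹ ≡ pow (suc k) (c ∙ m ∙ d)
      k,ω≡ = ω-pow M (c ∙ m ∙ d)

  stab-ε : ∀ {y} → Stab M y ε
  stab-ε = ε , trans (identityʳ _) (identityʳ _)

  -- The circuit that returns from y m to y by t, reads n, returns to y by s and reads m fixes y m
  -- and contains n.
  stab-step : ∀ {y m n} → Stab M y m → Stab M y n → Stab M (y ∙ m) n
  stab-step {y} {m} {n} (t , ymt) (s , yns) = stab-factor t n (s ∙ m) (begin
    y ∙ m ∙ (t ∙ n ∙ (s ∙ m)) ≡⟨ solve monoid ⟩
    y ∙ m ∙ t ∙ n ∙ s ∙ m     ≡⟨ cong (λ z → z ∙ n ∙ s ∙ m) ymt ⟩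
    y ∙ n ∙ s ∙ m             ≡⟨ cong (_∙ m) yns ⟩
    y ∙ m                     ∎)

  stab-∙ : ∀ {y m n} → Stab M y m → Stab M y n → Stab M y (m ∙ n)
  stab-∙ {y} {m} {n} p@(t , ymt) q with s , eq ← stab-step p q = s ∙ t , (begin
    y ∙ (m ∙ n) ∙ (s ∙ t) ≡⟨ solve monoid ⟩
    y ∙ m ∙ n ∙ s ∙ t     ≡⟨ cong (_∙ t) eq ⟩
    y ∙ m ∙ t             ≡⟨ ymt ⟩
    y                     ∎)

-- The identity is used only with x₃ = x₄ = … = 1.
module _ (n : ℕ) (M : FiniteMonoid) (uv : M ⊨ u (suc (suc n)) ≈ v (suc (suc n))) where
  open FiniteMonoid M hiding (Carrier) renaming (_^ω to _^ωᴹ)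

  -- Every outer factor of `extend` takes the value e = (ab)^ω, as does u₁, while v₁ takes the value
  -- f = (ba)^ω. The two sides collapse to e and to e f e.
  ω-sandwich : ∀ a b → (a ∙ b) ^ωᴹ ≡ (a ∙ b) ^ωᴹ ∙ ((b ∙ a) ^ωᴹ ∙ (a ∙ b) ^ωᴹ)
  ω-sandwich a b = begin
    e                             ≡⟨ trans (cong (e ∙_) (ω-idem M (a ∙ b))) (ω-idem M (a ∙ b)) ⟨
    e ∙ (e ∙ e)                   ≡⟨ cong (λ z → e ∙ (z ∙ e)) (value-u n) ⟨
    e ∙ (⟦_⟧ M (u (suc n)) ρ ∙ e) ≡⟨ value-extend n (u (suc n)) ⟨
    ⟦_⟧ M (u (suc (suc n))) ρ     ≡⟨ uv ρ ⟩
    ⟦_⟧ M (v (suc (suc n))) ρ     ≡⟨ value-v n ⟩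
    e ∙ (f ∙ e)                   ∎
    where
    ρ : ℕ → Carrier M
    ρ 1 = a
    ρ 2 = b
    ρ _ = ε

    e f : Carrier M
    e = (a ∙ b) ^ωᴹ
    f = (b ∙ a) ^ωᴹ

    free-trivial : ∀ (g : ℕ → ℕ) → (∀ i → ρ (suc (g i)) ≡ ε) → ∀ k → free M (ρ ∘ suc) (applyUpTo g k) ≡ ε
    free-trivial g eq zero    = refl
    free-trivial g eq (suc k) = begin
      ρ (suc (g 0)) ∙ _ ≡⟨ cong₂ _∙_ (eq 0) (free-trivial (g ∘ suc) (eq ∘ suc) k) ⟩
      ε ∙ ε             ≡⟨ identityˡ ε ⟩
      ε                 ∎

    value-extend : ∀ n t → ⟦_⟧ M (extend (suc n) t) ρ ≡ e ∙ (⟦_⟧ M t ρ ∙ e)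
    value-extend n t = trans (⟦extend⟧ M ρ (suc n) t) (cong₂ (λ y z → y ^ωᴹ ∙ (⟦_⟧ M t ρ ∙ z ^ωᴹ))
      (begin
        product M ρ (2 * suc n) ∙ ρ (2 * suc n + 1)
          ≡⟨ cong₂ _∙_ product≡ (cong ρ (trans (cong (_+ 1) (ℕ.*-suc 2 n)) (ℕ.+-comm (2 + 2 * n) 1))) ⟩
        a ∙ b ∙ ε    ≡⟨ identityʳ _ ⟩
        a ∙ b        ∎)
      (begin
        ρ (2 * suc n + 2) ∙ product M ρ (2 * suc n)
          ≡⟨ cong₂ _∙_ (cong ρ (trans (cong (_+ 2) (ℕ.*-suc 2 n)) (ℕ.+-comm (2 + 2 * n) 2))) product≡ ⟩
        ε ∙ (a ∙ b)  ≡⟨ identityˡ _ ⟩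
        a ∙ b        ∎))
      where
      product≡ : product M ρ (2 * suc n) ≡ a ∙ b
      product≡ = begin
        product M ρ (2 * suc n)   ≡⟨ cong (product M ρ) (ℕ.*-suc 2 n) ⟩
        a ∙ (b ∙ _)               ≡⟨ cong (λ z → a ∙ (b ∙ z)) (free-trivial (2 +_) (λ _ → refl) (2 * n)) ⟩
        a ∙ (b ∙ ε)               ≡⟨ cong (a ∙_) (identityʳ b) ⟩
        a ∙ b                     ∎

    value-u : ∀ n → ⟦_⟧ M (u (suc n)) ρ ≡ e
    value-u zero    = refl
    value-u (suc n) = begin
      ⟦_⟧ M (u (suc (suc n))) ρ     ≡⟨ value-extend n (u (suc n)) ⟩
      e ∙ (⟦_⟧ M (u (suc n)) ρ ∙ e) ≡⟨ cong (λ z → e ∙ (z ∙ e)) (value-u n) ⟩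
      e ∙ (e ∙ e)                   ≡⟨ trans (cong (e ∙_) (ω-idem M (a ∙ b))) (ω-idem M (a ∙ b)) ⟩
      e                             ∎

    value-v : ∀ n → ⟦_⟧ M (v (suc (suc n))) ρ ≡ e ∙ (f ∙ e)
    value-v zero    = value-extend 0 (v 1)
    value-v (suc n) = begin
      ⟦_⟧ M (v (suc (suc (suc n)))) ρ     ≡⟨ value-extend (suc n) (v (suc (suc n))) ⟩
      e ∙ (⟦_⟧ M (v (suc (suc n))) ρ ∙ e) ≡⟨ cong (λ z → e ∙ (z ∙ e)) (value-v n) ⟩
      e ∙ (e ∙ (f ∙ e) ∙ e)               ≡⟨ regroup e f ⟩
      e ∙ e ∙ (f ∙ (e ∙ e))               ≡⟨ cong₂ (λ y z → y ∙ (f ∙ z)) (ω-idem M (a ∙ b)) (ω-idem M (a ∙ b)) ⟩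
      e ∙ (f ∙ e)                         ∎
      where
      regroup : ∀ e f → e ∙ (e ∙ (f ∙ e) ∙ e) ≡ e ∙ e ∙ (f ∙ (e ∙ e))
      regroup e f = solve monoid

  -- Apply `ω-sandwich` to h a and b: the products h a b = h and b h a are already idempotent, so
  -- the ω-powers disappear.
  idem-sandwich : ∀ {h} a b → h ∙ h ≡ h → a ∙ b ≡ h → h ∙ (b ∙ h ∙ a) ∙ h ≡ h
  idem-sandwich {h} a b hh ab = begin
    h ∙ (b ∙ h ∙ a) ∙ h                       ≡⟨ cong (λ z → h ∙ z ∙ h) (ω-fixes-idem M bha-idem) ⟨
    h ∙ (b ∙ h ∙ a) ^ωᴹ ∙ h                   ≡⟨ cong (λ z → h ∙ z ^ωᴹ ∙ h) (assoc b h a) ⟩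
    h ∙ (b ∙ (h ∙ a)) ^ωᴹ ∙ h                 ≡⟨ cong (λ z → z ∙ (b ∙ (h ∙ a)) ^ωᴹ ∙ z) hab-ω ⟨
    (h ∙ a ∙ b) ^ωᴹ ∙ (b ∙ (h ∙ a)) ^ωᴹ ∙ (h ∙ a ∙ b) ^ωᴹ   ≡⟨ assoc _ _ _ ⟩
    (h ∙ a ∙ b) ^ωᴹ ∙ ((b ∙ (h ∙ a)) ^ωᴹ ∙ (h ∙ a ∙ b) ^ωᴹ) ≡⟨ ω-sandwich (h ∙ a) b ⟨
    (h ∙ a ∙ b) ^ωᴹ                           ≡⟨ hab-ω ⟩
    h                                         ∎
    where
    hab-ω : (h ∙ a ∙ b) ^ωᴹ ≡ h
    hab-ω = begin
      (h ∙ a ∙ b) ^ωᴹ ≡⟨ cong _^ωᴹ (trans (assoc h a b) (trans (cong (h ∙_) ab) hh)) ⟩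
      h ^ωᴹ           ≡⟨ ω-fixes-idem M hh ⟩
      h               ∎

    bha-idem : b ∙ h ∙ a ∙ (b ∙ h ∙ a) ≡ b ∙ h ∙ a
    bha-idem = begin
      b ∙ h ∙ a ∙ (b ∙ h ∙ a)   ≡⟨ solve monoid ⟩
      b ∙ (h ∙ (a ∙ b) ∙ h) ∙ a ≡⟨ cong (λ z → b ∙ (h ∙ z ∙ h) ∙ a) ab ⟩
      b ∙ (h ∙ h ∙ h) ∙ a       ≡⟨ cong (λ z → b ∙ z ∙ a) (trans (cong (_∙ h) hh) hh) ⟩
      b ∙ h ∙ a                 ∎

  factorsStabilise : FactorsStabilise M
  -- As h = c (m d), `idem-sandwich` gives h (m d h c) h = h; the witness is what follows m.
  factorsStabilise {h} c m d hh h≡ = d ∙ h ∙ c ∙ h , trans (regroup h) (idem-sandwich c (m ∙ d) hh (sym (trans h≡ (assoc c m d))))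
    where
    regroup : ∀ h → h ∙ m ∙ (d ∙ h ∙ c ∙ h) ≡ h ∙ (m ∙ d ∙ h ∙ c) ∙ h
    regroup h = solve monoid

  factorsStabilise-op : FactorsStabilise (op M)
  factorsStabilise-op {h} c m d hh h≡ = h ∙ c ∙ h ∙ d , trans (regroup h) (idem-sandwich (d ∙ m) c hh (trans (assoc d m c) (sym h≡)))
    where
    regroup : ∀ h → h ∙ c ∙ h ∙ d ∙ (m ∙ h) ≡ h ∙ (c ∙ h ∙ (d ∙ m)) ∙ h
    regroup h = solve monoid

-- Local monoids at a pair of elements

update : {X : Set} → (ℕ → X) → ℕ → X → ℕ → X
update ρ k a i = if ⌊ i ℕ.≟ k ⌋ then a else ρ i

module _ {X : Set} (ρ : ℕ → X) (k : ℕ) (a : X) where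
  update-at : update ρ k a k ≡ a
  update-at with k ℕ.≟ k
  ... | yes _  = refl
  ... | no k≢k = contradiction refl k≢k

  update-other : ∀ {i} → i ≢ k → update ρ k a i ≡ ρ i
  update-other {i} i≢k with i ℕ.≟ k
  ... | yes i≡k = contradiction i≡k i≢k
  ... | no _    = refl

free-cong : ∀ {A : Set} M {θ η : A → Carrier M} w → (∀ {a} → a ∈ w → θ a ≡ η a) → free M θ w ≡ free M η w
free-cong M []      eq = refl
free-cong M (a ∷ w) eq = cong₂ _∙_ (eq (here refl)) (free-cong M w (eq ∘ there))
  where open FiniteMonoid M hiding (Carrier)

module Local (M : FiniteMonoid) (stable : FactorsStabilise M) (stableᵒ : FactorsStabilise (op M))
  (y z : Carrier M) where
  open FiniteMonoid M hiding (Carrier) renaming (_^ω to _^ωᴹ)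
  private
    module R = Stabilisers M stable
    module L = Stabilisers (op M) stableᵒ

  Stab₂ : Carrier M → Set
  Stab₂ m = Stab M y m × Stab (op M) z m

  Stab₂? : ∀ m → Dec (Stab₂ m)
  Stab₂? m = Stab? M y m ×-dec Stab? (op M) z m

  stab₂-ε : Stab₂ ε
  stab₂-ε = R.stab-ε , L.stab-ε

  stab₂-∙ : ∀ {a b} → Stab₂ a → Stab₂ b → Stab₂ (a ∙ b)
  stab₂-∙ (p , p′) (q , q′) = R.stab-∙ p q , L.stab-∙ q′ p′

  stab₂-free : ∀ {A : Set} {θ : A → Carrier M} → (∀ a → Stab₂ (θ a)) → ∀ w → Stab₂ (free M θ w)
  stab₂-free p []      = stab₂-ε
  stab₂-free p (a ∷ w) = stab₂-∙ (p a) (stab₂-free p w)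

  open Submonoid M Stab₂? stab₂-ε stab₂-∙ public
  private
    module S = FiniteMonoid submonoid

    stab : (c : Elem) → Stab₂ (proj₁ c)
    stab c = toWitness (proj₂ c)

  within : Elem → Elem → Carrier M → Carrier M
  within c d m = y ∙ proj₁ c ∙ m ∙ (proj₁ d ∙ z)

  infix 4 _≈_
  -- The coarsest congruence on the submonoid whose classes still determine the product y m z.
  _≈_ : Elem → Elem → Set
  m ≈ n = ∀ c d → within c d (proj₁ m) ≡ within c d (proj₁ n)

  _≈?_ : ∀ m n → Dec (m ≈ n)
  m ≈? n = all-finite? S.finite λ c → all-finite? S.finite λ d → finite⇒≟ finite _ _

  ≈-cong : ∀ {k l m n} → k ≈ l → m ≈ n → k S.∙ m ≈ l S.∙ n
  ≈-cong {k , _} {l , q} {m , p} {n , _} k≈l m≈n c d = begin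
    y ∙ proj₁ c ∙ (k ∙ m) ∙ (proj₁ d ∙ z) ≡⟨ regroupʳ k m (proj₁ d) ⟩
    y ∙ proj₁ c ∙ k ∙ (m ∙ proj₁ d ∙ z)   ≡⟨ k≈l c ((m , p) S.∙ d) ⟩
    y ∙ proj₁ c ∙ l ∙ (m ∙ proj₁ d ∙ z)   ≡⟨ regroupˡ (proj₁ c) l m (proj₁ d) ⟩
    y ∙ (proj₁ c ∙ l) ∙ m ∙ (proj₁ d ∙ z) ≡⟨ m≈n (c S.∙ (l , q)) d ⟩
    y ∙ (proj₁ c ∙ l) ∙ n ∙ (proj₁ d ∙ z) ≡⟨ cong (_∙ (proj₁ d ∙ z)) (regroup (proj₁ c) l n) ⟩
    y ∙ proj₁ c ∙ (l ∙ n) ∙ (proj₁ d ∙ z) ∎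
    where
    regroupʳ : ∀ k m d → y ∙ proj₁ c ∙ (k ∙ m) ∙ (d ∙ z) ≡ y ∙ proj₁ c ∙ k ∙ (m ∙ d ∙ z)
    regroupʳ k m d = solve monoid
    regroupˡ : ∀ c l m d → y ∙ c ∙ l ∙ (m ∙ d ∙ z) ≡ y ∙ (c ∙ l) ∙ m ∙ (d ∙ z)
    regroupˡ c l m d = solve monoid
    regroup : ∀ c l n → y ∙ (c ∙ l) ∙ n ≡ y ∙ c ∙ (l ∙ n)
    regroup c l n = solve monoid

  open Quotient submonoid {_≈_} _≈?_ (λ _ _ → refl) (λ p c d → sym (p c d)) (λ p q c d → trans (p c d) (q c d))
    (λ {k} {l} {m} {n} → ≈-cong {k} {l} {m} {n})

  -- x₂ₙ₊₁ and x₂ₙ₊₂ are chosen so that the two outer factors of extend n are absorbed by the context.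
  absorb-extend : ∀ n (ρ : ℕ → Elem) (c d : Elem) → ∃[ ρ′ ] (∀ t → Vars (UpTo (2 * n)) t →
    within c d (⟦_⟧ M t (proj₁ ∘ ρ)) ≡ within c d (⟦_⟧ M (extend n t) ρ′))
  absorb-extend n ρ c d = ρ′ , λ t t-vars → sym (trans
      (⟦extend⟧-absorb M ρ′ n {y ∙ proj₁ c} {proj₁ d ∙ z} left-fixes right-fixes t)
      (cong (within c d) (⟦⟧-cong M {UpTo (2 * n)} ρ′-below t t-vars)))
    where
    k : ℕ
    k = 2 * n

    P : Carrier M
    P = product M (proj₁ ∘ ρ) k

    P-stab : Stab₂ P
    P-stab = stab₂-free (stab ∘ ρ ∘ suc) (upTo k)

    left-stab : Stab M (y ∙ proj₁ c) P
    left-stab = R.stab-step (proj₁ (stab c)) (proj₁ P-stab)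

    right-stab : Stab (op M) (proj₁ d ∙ z) P
    right-stab = L.stab-step (proj₂ (stab d)) (proj₂ P-stab)

    ρ₁ ρ′ : ℕ → Carrier M
    ρ₁ = update (proj₁ ∘ ρ) (k + 1) (proj₁ left-stab)
    ρ′ = update ρ₁ (k + 2) (proj₁ right-stab)

    ρ′-below : ∀ {i} → UpTo k i → ρ′ i ≡ proj₁ (ρ i)
    ρ′-below (j , j<k , refl) = trans
      (update-other ρ₁ (k + 2) _ (ℕ.<⇒≢ (ℕ.≤-<-trans j<k (ℕ.m<m+n k ℕ.z<s))))
      (update-other (proj₁ ∘ ρ) (k + 1) _ (ℕ.<⇒≢ (ℕ.≤-<-trans j<k (ℕ.m<m+n k ℕ.z<s))))

    product≡ : product M ρ′ k ≡ P
    product≡ = free-cong M (upTo k) (λ j∈ → ρ′-below (_ , ∈-upTo⁻ j∈ , refl))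

    left-fixes : y ∙ proj₁ c ∙ (product M ρ′ k ∙ ρ′ (k + 1)) ≡ y ∙ proj₁ c
    left-fixes = begin
      _                                       ≡⟨ cong₂ (λ p t → y ∙ proj₁ c ∙ (p ∙ t)) product≡ ρ′-k+1 ⟩
      y ∙ proj₁ c ∙ (P ∙ proj₁ left-stab)     ≡⟨ assoc _ _ _ ⟨
      y ∙ proj₁ c ∙ P ∙ proj₁ left-stab       ≡⟨ proj₂ left-stab ⟩
      y ∙ proj₁ c                             ∎
      where
      ρ′-k+1 : ρ′ (k + 1) ≡ proj₁ left-stab
      ρ′-k+1 = trans (update-other ρ₁ (k + 2) _ (ℕ.<⇒≢ (ℕ.+-monoʳ-< k (ℕ.n<1+n 1))))
                     (update-at (proj₁ ∘ ρ) (k + 1) _)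

    right-fixes : ρ′ (k + 2) ∙ product M ρ′ k ∙ (proj₁ d ∙ z) ≡ proj₁ d ∙ z
    right-fixes = begin
      _                                       ≡⟨ cong₂ (λ t p → t ∙ p ∙ (proj₁ d ∙ z)) (update-at ρ₁ (k + 2) _) product≡ ⟩
      proj₁ right-stab ∙ P ∙ (proj₁ d ∙ z)    ≡⟨ assoc _ _ _ ⟩
      proj₁ right-stab ∙ (P ∙ (proj₁ d ∙ z))  ≡⟨ proj₂ right-stab ⟩
      proj₁ d ∙ z                             ∎

  private
    ⟦⟧-quotient : ∀ (ρ : ℕ → Carrier quotient) t → ⟦_⟧ quotient t ρ ≡ [ ⟦_⟧ submonoid t (representative ∘ ρ) ]≈
    ⟦⟧-quotient ρ t = trans
      (sym (⟦⟧-ext quotient (λ i → [representative] (ρ i)) t))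
      (sym (⟦⟧-morphism submonoid quotient projection t (representative ∘ ρ)))

    -- Valuations in the quotient lift to representatives, and by the definition of the congruence
    -- it is enough to compare values between y c and d z.
    quotient-satisfies : ∀ s t →
      (∀ (ρ : ℕ → Elem) c d → within c d (⟦_⟧ M s (proj₁ ∘ ρ)) ≡ within c d (⟦_⟧ M t (proj₁ ∘ ρ))) →
      quotient ⊨ s ≈ t
    quotient-satisfies s t eq ρ =
      trans (⟦⟧-quotient ρ s) (trans ([]≈-cong s≈t) (sym (⟦⟧-quotient ρ t)))
      where
      included : ∀ t → proj₁ (⟦_⟧ submonoid t (representative ∘ ρ)) ≡ ⟦_⟧ M t (proj₁ ∘ representative ∘ ρ)
      included t = ⟦⟧-morphism submonoid M inclusion t (representative ∘ ρ)

      s≈t : ⟦_⟧ submonoid s (representative ∘ ρ) ≈ ⟦_⟧ submonoid t (representative ∘ ρ)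
      s≈t c d = trans (cong (within c d) (included s))
        (trans (eq (representative ∘ ρ) c d) (cong (within c d) (sym (included t))))

    -- In each context, s and t may be exchanged for `extend n s` and `extend n t` under a modified
    -- valuation, to which the identity of M applies. The new valuation depends on c and d and takes
    -- values in all of M.
    quotient-satisfies-core : ∀ n {s t} → Vars (UpTo (2 * n)) s → Vars (UpTo (2 * n)) t →
      M ⊨ extend n s ≈ extend n t → quotient ⊨ s ≈ t
    quotient-satisfies-core n {s} {t} s-vars t-vars M⊨ = quotient-satisfies s t λ ρ c d →
      let ρ′ , absorb = absorb-extend n ρ c d
      in trans (absorb s s-vars) (trans (cong (within c d) (M⊨ ρ′)) (sym (absorb t t-vars)))

  private
    classOf : ∀ {m} → Dec (Stab₂ m) → Carrier quotient
    classOf {m} (yes p) = [ m , fromWitness p ]≈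
    -- A default value for elements outside the submonoid; decoding concerns words of stabilising
    -- letters.
    classOf     (no _)  = FiniteMonoid.ε quotient

    classOf-stab : ∀ {m} (p : Stab₂ m) (d : Dec (Stab₂ m)) → classOf d ≡ [ m , fromWitness p ]≈
    classOf-stab p (yes _) = []≈-cong (λ c d → refl)
    classOf-stab p (no ¬p) = contradiction p ¬p

    toQuotient : Carrier M → Carrier quotient
    toQuotient m = classOf (Stab₂? m)

    infixl 7 _⊙_
    _⊙_ : Carrier quotient → Carrier quotient → Carrier quotient
    _⊙_ = FiniteMonoid._∙_ quotient

    free-toQuotient : ∀ w → All Stab₂ w → ∃[ e ] proj₁ e ≡ free M id w × free quotient toQuotient w ≡ [ e ]≈
    free-toQuotient []      []       = S.ε , refl , sym (IsMonoidHomomorphism.ε-homo projection)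
    free-toQuotient (m ∷ w) (p ∷ ps) = let e , e≡ , eq = free-toQuotient w ps in
      (m , fromWitness p) S.∙ e , cong (m ∙_) e≡ , (begin
        toQuotient m ⊙ free quotient toQuotient w ≡⟨ cong₂ _⊙_ (classOf-stab p (Stab₂? m)) eq ⟩
        [ m , fromWitness p ]≈ ⊙ [ e ]≈       ≡⟨ IsMonoidHomomorphism.homo projection (m , fromWitness p) e ⟨
        [ (m , fromWitness p) S.∙ e ]≈        ∎)

  abstract
    local : FiniteMonoid
    local = quotient

    local-Identities : ∀ n → Identities (suc n) M → Identities n local
    local-Identities n (uv , ap) =
      quotient-satisfies-core (suc n) {u (suc n)} {v (suc n)} (Vars-u n) (Vars-v n) uv ,
      quotient-satisfies (x 1 ^ω) (x 1 · x 1 ^ω) (λ ρ c d → cong (within c d) (ap (proj₁ ∘ ρ)))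

    toLocal : Carrier M → Carrier local
    toLocal = toQuotient

    -- Equality in the quotient is equality in all contexts c, d; the instance c = d = 1 is read
    -- off.
    toLocal-decode : ∀ w w′ → All Stab₂ w → All Stab₂ w′ →
      free local toLocal w ≡ free local toLocal w′ → y ∙ free M id w ∙ z ≡ y ∙ free M id w′ ∙ z
    toLocal-decode w w′ ps ps′ eq =
      let e , e≡ , q = free-toQuotient w ps
          e′ , e′≡ , q′ = free-toQuotient w′ ps′ in begin
      y ∙ free M id w ∙ z           ≡⟨ units _ ⟩
      within S.ε S.ε (free M id w)  ≡⟨ cong (within S.ε S.ε) e≡ ⟨
      within S.ε S.ε (proj₁ e)      ≡⟨ ≡⇒≈ {e} {e′} (trans (sym q) (trans eq q′)) S.ε S.ε ⟩
      within S.ε S.ε (proj₁ e′)     ≡⟨ cong (within S.ε S.ε) e′≡ ⟩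
      within S.ε S.ε (free M id w′) ≡⟨ units _ ⟨
      y ∙ free M id w′ ∙ z          ∎
      where
      units : ∀ m → y ∙ m ∙ z ≡ y ∙ ε ∙ m ∙ (ε ∙ z)
      units m = solve monoid

-- J-trivial monoids that record subwords

module _ (M : FiniteMonoid) where
  open FiniteMonoid M hiding (Carrier)

  ideal-refl : ∀ {s} → ideal M s s
  ideal-refl = ε , ε , sym (trans (identityʳ _) (identityˡ _))

JTrivial-productClosed : ProductClosed JTrivial
JTrivial-productClosed = (λ _ _ _ → refl) , λ M N M-J N-J (s , s′) (t , t′) (s⊆t , t⊆s) →
  let a , b , s≡ = s⊆t (ideal-refl (M ⊗ N))
      c , d , t≡ = t⊆s (ideal-refl (M ⊗ N))
  in cong₂ _,_ (JTriviality.J-antisym M M-J (cong proj₁ s≡) (cong proj₁ t≡))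
               (JTriviality.J-antisym N N-J (cong proj₂ s≡) (cong proj₂ t≡))

-- Monotone extensive self-maps of a finite chain

module Chain (n : ℕ) where
  transformations : FiniteMonoid
  transformations = record
    { Carrier = Vec (Fin n) n
    ; _∙_ = λ f g → tabulate (lookup g ∘ lookup f)
    ; ε = tabulate id
    ; isMonoid = mkIsMonoid
        (λ f g h → Vec.tabulate-cong λ i → begin
          lookup h (lookup (tabulate (lookup g ∘ lookup f)) i)      ≡⟨ cong (lookup h) (Vec.lookup∘tabulate _ i) ⟩
          lookup h (lookup g (lookup f i))                          ≡⟨ Vec.lookup∘tabulate _ (lookup f i) ⟨
          lookup (tabulate (lookup h ∘ lookup g)) (lookup f i)      ∎)
        (λ f → trans (Vec.tabulate-cong (λ i → cong (lookup f) (Vec.lookup∘tabulate id i))) (Vec.tabulate∘lookup f))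
        (λ f → trans (Vec.tabulate-cong (λ i → Vec.lookup∘tabulate id (lookup f i))) (Vec.tabulate∘lookup f))
    ; finite = finite-Vec (n , ↔-refl) n }

  MonotoneExtensive : (Fin n → Fin n) → Set
  MonotoneExtensive f = (∀ i j → i Fin.≤ j → f i Fin.≤ f j) × (∀ i → i Fin.≤ f i)

  monotoneExtensive? : ∀ f → Dec (MonotoneExtensive f)
  monotoneExtensive? f =
    Fin.all? (λ i → Fin.all? λ j → (i Fin.≤? j) →-dec (f i Fin.≤? f j)) ×-dec Fin.all? (λ i → i Fin.≤? f i)

  monotoneExtensive-cong : ∀ {f g} → (∀ i → f i ≡ g i) → MonotoneExtensive f → MonotoneExtensive g
  monotoneExtensive-cong f≗g (mono , ext) =
    (λ i j i≤j → subst₂ Fin._≤_ (f≗g i) (f≗g j) (mono i j i≤j)) , λ i → subst (i Fin.≤_) (f≗g i) (ext i)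

  open Submonoid transformations {MonotoneExtensive ∘ lookup} (monotoneExtensive? ∘ lookup)
    (monotoneExtensive-cong (λ i → sym (Vec.lookup∘tabulate id i)) ((λ _ _ → id) , λ _ → ℕ.≤-refl))
    (λ {f} {g} (f-mono , f-ext) (g-mono , g-ext) →
      monotoneExtensive-cong (λ i → sym (Vec.lookup∘tabulate (lookup g ∘ lookup f) i))
        ((λ i j → g-mono _ _ ∘ f-mono i j) , λ i → ℕ.≤-trans (f-ext i) (g-ext _)))

  abstract
    chain : FiniteMonoid
    chain = submonoid

    apply : Carrier chain → Fin n → Fin n
    apply f = lookup (proj₁ f)

    apply-∙ : ∀ f g i → apply (FiniteMonoid._∙_ chain f g) i ≡ apply g (apply f i)
    apply-∙ f g = Vec.lookup∘tabulate _

    apply-ε : ∀ i → apply (FiniteMonoid.ε chain) i ≡ i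
    apply-ε = Vec.lookup∘tabulate id

    apply-property : ∀ f → MonotoneExtensive (apply f)
    apply-property f = toWitness (proj₂ f)

    apply-injective : ∀ f g → (∀ i → apply f i ≡ apply g i) → f ≡ g
    apply-injective f g f≗g = ≡-elem (begin
      proj₁ f            ≡⟨ Vec.tabulate∘lookup (proj₁ f) ⟨
      tabulate (apply f) ≡⟨ Vec.tabulate-cong f≗g ⟩
      tabulate (apply g) ≡⟨ Vec.tabulate∘lookup (proj₁ g) ⟩
      proj₁ g            ∎)

    fromFunction : (f : Fin n → Fin n) → MonotoneExtensive f → Carrier chain
    fromFunction f p = tabulate f , fromWitness (monotoneExtensive-cong (λ i → sym (Vec.lookup∘tabulate f i)) p)

    apply-fromFunction : ∀ f p i → apply (fromFunction f p) i ≡ f i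
    apply-fromFunction f p = Vec.lookup∘tabulate f

  open FiniteMonoid chain hiding (Carrier)

  private
    factor-≤ : ∀ s t → ideal chain t s → ∀ i → apply t i Fin.≤ apply s i
    factor-≤ _ t (a , b , refl) i = subst (apply t i Fin.≤_)
      (sym (trans (apply-∙ (a ∙ t) b i) (cong (apply b) (apply-∙ a t i))))
      (ℕ.≤-trans (proj₁ (apply-property t) _ _ (proj₂ (apply-property a) i)) (proj₂ (apply-property b) _))

  -- By extensivity and monotonicity a t b is pointwise at least t. Maps that generate the same
  -- ideal bound each other and so coincide.
  chain-JTrivial : JTrivial chain
  chain-JTrivial s t (s⊆t , t⊆s) = apply-injective s t λ i → Fin.≤-antisym
    (factor-≤ t s (t⊆s (ideal-refl chain)) i)
    (factor-≤ s t (s⊆t (ideal-refl chain)) i)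

-- Subword automata

module _ {A : Set} (_≟_ : DecidableEquality A) where

  -- State i means that the first i letters of z have been matched greedily; a letter advances it
  -- exactly when it is the next letter of z.
  step : A → (z : List A) → Fin (suc (length z)) → Fin (suc (length z))
  step a []      i       = i
  step a (c ∷ z) zero    with a ≟ c
  ... | yes _ = suc zero
  ... | no  _ = zero
  step a (c ∷ z) (suc i) = suc (step a z i)

  step-extensive : ∀ a z i → i Fin.≤ step a z i
  step-extensive a []      i       = ℕ.≤-refl
  step-extensive a (c ∷ z) zero    = z≤n
  step-extensive a (c ∷ z) (suc i) = s≤s (step-extensive a z i)

  step-monotone : ∀ a z i j → i Fin.≤ j → step a z i Fin.≤ step a z j
  step-monotone a []      i       j       i≤j       = i≤j
  step-monotone a (c ∷ z) zero    zero    _         = ℕ.≤-refl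
  step-monotone a (c ∷ z) zero    (suc j) _         with a ≟ c
  ... | yes _ = s≤s z≤n
  ... | no  _ = z≤n
  step-monotone a (c ∷ z) (suc i) (suc j) (s≤s i≤j) = s≤s (step-monotone a z i j i≤j)

  run : List A → (z : List A) → Fin (suc (length z)) → Fin (suc (length z))
  run []      z i = i
  run (a ∷ w) z i = run w z (step a z i)

  run-suc : ∀ w c z i → run w (c ∷ z) (suc i) ≡ suc (run w z i)
  run-suc []      c z i = refl
  run-suc (a ∷ w) c z i = run-suc w c z (step a z i)

  run⇒⊆ : ∀ w z → run w z zero ≡ fromℕ (length z) → z ⊆ w
  run⇒⊆ w       []      _  = minimum w
  run⇒⊆ (a ∷ w) (c ∷ z) eq with a ≟ c
  ... | yes refl = refl ∷ run⇒⊆ w z (Fin.suc-injective (trans (sym (run-suc w c z zero)) eq))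
  ... | no  _    = a ∷ʳ run⇒⊆ w (c ∷ z) eq

  -- Greedy matching is optimal: if an embedding skips a letter equal to the head of z, the tail of
  -- z still embeds in the rest of w.
  ⊆⇒run : ∀ w z → z ⊆ w → run w z zero ≡ fromℕ (length z)
  ⊆⇒run w       []      _ with run w [] zero
  ... | zero = refl
  ⊆⇒run (a ∷ w) (c ∷ z) p with a ≟ c | p
  ... | yes _  | _ ∷ʳ q   = trans (run-suc w c z zero) (cong suc (⊆⇒run w z (∷ˡ⁻ q)))
  ... | yes _  | _ ∷ q    = trans (run-suc w c z zero) (cong suc (⊆⇒run w z q))
  ... | no _   | _ ∷ʳ q   = ⊆⇒run w (c ∷ z) q
  ... | no a≢c | refl ∷ _ = contradiction refl a≢c

  module _ (z : List A) where
    open Chain (suc (length z))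

    letter : A → Carrier chain
    letter a = fromFunction (step a z) (step-monotone a z , step-extensive a z)

    apply-free : ∀ w i → apply (free chain letter w) i ≡ run w z i
    apply-free []      i = apply-ε i
    apply-free (a ∷ w) i = begin
      apply (letter a ∙ free chain letter w) i       ≡⟨ apply-∙ (letter a) (free chain letter w) i ⟩
      apply (free chain letter w) (apply (letter a) i) ≡⟨ apply-free w (apply (letter a) i) ⟩
      run w z (apply (letter a) i)                   ≡⟨ cong (run w z) (apply-fromFunction (step a z) _ i) ⟩
      run w z (step a z i)                           ∎
      where open FiniteMonoid chain hiding (Carrier)

    free-letter-⊆ : ∀ v w → free chain letter v ≡ free chain letter w → z ⊆ v → z ⊆ w
    free-letter-⊆ v w eq z⊆v = run⇒⊆ w z (begin
      run w z zero                            ≡⟨ apply-free w zero ⟨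
      apply (free chain letter w) zero        ≡⟨ cong (λ f → apply f zero) eq ⟨
      apply (free chain letter v) zero        ≡⟨ apply-free v zero ⟩
      run v z zero                            ≡⟨ ⊆⇒run v z z⊆v ⟩
      fromℕ (length z)                        ∎)

words : {A : Set} → List A → ℕ → List (List A)
words as zero    = [ [] ]
words as (suc k) = [] ∷ cartesianProductWith _∷_ as (words as k)

∈-words : {A : Set} {as : List A} → (∀ a → a ∈ as) → ∀ k w → length w ≤ k → w ∈ words as k
∈-words ∈as zero    []      _         = here refl
∈-words ∈as (suc k) []      _         = here refl
∈-words ∈as (suc k) (a ∷ w) (s≤s w≤k) = there (∈-cartesianProductWith⁺ _∷_ (∈as a) (∈-words ∈as k w w≤k))

SameSubwords : {A : Set} → ℕ → List A → List A → Set
SameSubwords k v w = ∀ z → length z ≤ k → z ⊆ v → z ⊆ w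

abstract
  -- The product of the chain automata of all words of length at most k.
  subwords-recognised : {A : Set} → Finite A → ∀ k → Σ[ N ∈ FiniteMonoid ] Σ[ θ ∈ (A → Carrier N) ]
    JTrivial N × (∀ v w → free N θ v ≡ free N θ w → SameSubwords k v w)
  subwords-recognised A-fin k
    with N , θ , N-J , sep ← joint {C = JTrivial} JTrivial-productClosed
           (λ z → Chain.chain (suc (length z))) (λ z → Chain.chain-JTrivial (suc (length z)))
           (λ z → letter (finite⇒≟ A-fin) z) (words (elements A-fin) k) =
    N , θ , N-J , λ v w eq z z≤k → free-letter-⊆ (finite⇒≟ A-fin) z v w (sep v w eq (∈-words (∈-elements A-fin) k z z≤k))

-- Leaving R-classes and L-classes along subwords

module _ {A : Set} {P Q : A → Set} (P? : Decidable P) (Q? : Decidable Q) (P⇒Q : ∀ {a} → P a → Q a) where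

  filter-length-≤ : ∀ as → length (filter P? as) ≤ length (filter Q? as)
  filter-length-≤ []       = z≤n
  filter-length-≤ (a ∷ as) with P? a | Q? a
  ... | yes _ | yes _ = s≤s (filter-length-≤ as)
  ... | yes p | no ¬q = contradiction (P⇒Q p) ¬q
  ... | no _  | yes _ = ℕ.m≤n⇒m≤1+n (filter-length-≤ as)
  ... | no _  | no _  = filter-length-≤ as

  filter-length-< : ∀ {a as} → a ∈ as → Q a → ¬ P a → length (filter P? as) < length (filter Q? as)
  filter-length-< {a} {_ ∷ as} (here refl) q ¬p with P? a | Q? a
  ... | yes p | _     = contradiction p ¬p
  ... | no _  | yes _ = s≤s (filter-length-≤ as)
  ... | no _  | no ¬q = contradiction q ¬q
  filter-length-< {a} {b ∷ as} (there a∈) q ¬p with P? b | Q? b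
  ... | yes _ | yes _ = s≤s (filter-length-< a∈ q ¬p)
  ... | yes p | no ¬q = contradiction (P⇒Q p) ¬q
  ... | no _  | yes _ = ℕ.m≤n⇒m≤1+n (filter-length-< a∈ q ¬p)
  ... | no _  | no _  = filter-length-< a∈ q ¬p

-- A word leaves its R-class at most |M| times; the additional one is for the letter appended to the
-- subword of leaving letters.
depth : FiniteMonoid → ℕ
depth M = suc (length (elements (FiniteMonoid.finite M)))

-- The letters at which the prefixes of w leave their R-class form a subword z of w. All other letters stabilise
-- the current R-class, so z is matched greedily, and z b is not a subword of w when b would leave the last R-class.
module Descent (M : FiniteMonoid) (stable : FactorsStabilise M) where
  open FiniteMonoid M hiding (Carrier)
  open Stabilisers M stable

  data Descents : Carrier M → List (Carrier M) → List (Carrier M) → Set where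
    []   : ∀ {y} → Descents y [] []
    stay : ∀ {y a w z} → Stab M y a → Descents (y ∙ a) w z → Descents y (a ∷ w) z
    leave : ∀ {y a w z} → ¬ Stab M y a → Descents (y ∙ a) w z → Descents y (a ∷ w) (a ∷ z)

  descents : ∀ y w → ∃ (Descents y w)
  descents y []      = [] , []
  descents y (a ∷ w) with Stab? M y a | descents (y ∙ a) w
  ... | yes p | z , d = z , stay p d
  ... | no ¬p | z , d = a ∷ z , leave ¬p d

  descents-⊆ : ∀ {y w z} → Descents y w z → z ⊆ w
  descents-⊆ []         = []
  descents-⊆ (stay _ d) = _ ∷ʳ descents-⊆ d
  descents-⊆ (leave _ d) = refl ∷ descents-⊆ d

  -- The head of z b leaves the R-class reached where it is read. The letters before it stay in the
  -- class of y, and by `stab-step` a letter stabilising y would stabilise every element reached by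
  -- them.
  head-unstable : ∀ {y w z b c z′} → Descents y w z → ¬ Stab M (y ∙ free M id w) b → c ∷ z′ ≡ z ++ [ b ] → ¬ Stab M y c
  head-unstable {y} []             ¬b refl s = ¬b (subst (λ y → Stab M y _) (sym (identityʳ y)) s)
  head-unstable {y} (stay {a = a} p d) ¬b eq   s =
    head-unstable d (¬b ∘ subst (λ y → Stab M y _) (assoc y a _)) eq (stab-step p s)
  head-unstable (leave ¬p d)        ¬b refl s = ¬p s

  -- An embedding of z b cannot match its head with a letter at which w stays, by `head-unstable`.
  -- Where w leaves the class, the head of z is dropped and the claim passes to the rest.
  not-⊆ : ∀ {y w z b} → Descents y w z → ¬ Stab M (y ∙ free M id w) b → ¬ (z ++ [ b ] ⊆ w)
  not-⊆ {y} {a ∷ w} {[]} (stay p d) ¬b (_ ∷ʳ q) = not-⊆ d (¬b ∘ subst (λ y → Stab M y _) (assoc y a _)) q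
  not-⊆ {z = []} d@(stay p _) ¬b (refl ∷ _) = head-unstable d ¬b refl p
  not-⊆ {y} {a ∷ w} {_ ∷ _} (stay p d) ¬b (_ ∷ʳ q) = not-⊆ d (¬b ∘ subst (λ y → Stab M y _) (assoc y a _)) q
  not-⊆ {z = _ ∷ _} d@(stay p _) ¬b (refl ∷ _) = head-unstable d ¬b refl p
  not-⊆ {y} {a ∷ w} (leave _ d) ¬b (_ ∷ʳ q) = not-⊆ d (¬b ∘ subst (λ y → Stab M y _) (assoc y a _)) (∷ˡ⁻ q)
  not-⊆ {y} {a ∷ w} (leave _ d) ¬b (_ ∷ q)  = not-⊆ d (¬b ∘ subst (λ y → Stab M y _) (assoc y a _)) q

  private
    Multiple : Carrier M → Carrier M → Set
    Multiple y m = ∃[ t ] y ∙ t ≡ m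

    multiple? : ∀ y m → Dec (Multiple y m)
    multiple? y m = any-finite? finite (λ t → finite⇒≟ finite (y ∙ t) m)

    multiple-∙ : ∀ {y a m} → Multiple (y ∙ a) m → Multiple y m
    multiple-∙ (t , eq) = _ , trans (sym (assoc _ _ t)) eq

    -- The size of the right ideal y M. It drops strictly when the R-class is left, since then y is
    -- no multiple of y a.
    rank : Carrier M → ℕ
    rank y = length (filter (multiple? y) (elements finite))

  descents-length : ∀ {y w z} → Descents y w z → length z ≤ rank y
  descents-length []              = z≤n
  descents-length (stay {y} {a} _ d) = ℕ.≤-trans (descents-length d)
    (filter-length-≤ (multiple? (y ∙ a)) (multiple? y) multiple-∙ (elements finite))
  descents-length (leave {y} {a} ¬p d) = ℕ.≤-<-trans (descents-length d)
    (filter-length-< (multiple? (y ∙ a)) (multiple? y) multiple-∙ (∈-elements finite y) (ε , identityʳ y) ¬p)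

  -- Let z be the subword of leaving letters of w. If b left the last R-class, z b would be a
  -- subword of w b, short enough to be recorded, but not of w.
  subwords⇒stab : ∀ w b → SameSubwords (depth M) (w ++ [ b ]) w → Stab M (free M id w) b
  subwords⇒stab w b same = decidable-stable (Stab? M (free M id w) b) λ ¬s →
    let z , d = descents ε w
    in not-⊆ d (¬s ∘ subst (λ y → Stab M y b) (identityˡ _))
         (same (z ++ [ b ])
           (subst (_≤ depth M) (sym (trans (List.length-++ z) (ℕ.+-comm (length z) 1)))
             (s≤s (ℕ.≤-trans (descents-length d) (List.length-filter (multiple? ε) (elements finite)))))
           (Sublist.++⁺ (descents-⊆ d) ⊆-refl))

module _ (M : FiniteMonoid) (stable : FactorsStabilise (op M)) where
  open FiniteMonoid M hiding (Carrier)

  free-reverse : ∀ w → free (op M) id (reverse w) ≡ free M id w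
  free-reverse []      = refl
  free-reverse (a ∷ w) = begin
    free (op M) id (reverse (a ∷ w))             ≡⟨ cong (free (op M) id) (List.unfold-reverse a w) ⟩
    free (op M) id (reverse w ++ [ a ])          ≡⟨ free-++ (op M) id (reverse w) [ a ] ⟩
    ε ∙ a ∙ free (op M) id (reverse w)           ≡⟨ cong₂ _∙_ (identityˡ a) (free-reverse w) ⟩
    a ∙ free M id w                              ∎

  -- Reversal turns suffixes read in M into prefixes read in `op M` and preserves the subword
  -- relation.
  subwords⇒stab-op : ∀ b w → SameSubwords (depth M) (b ∷ w) w → Stab (op M) (free M id w) b
  subwords⇒stab-op b w same = subst (λ y → Stab (op M) y b) (free-reverse w)
    (Descent.subwords⇒stab (op M) stable (reverse w) b λ z z≤ z⊆ →
      subst (_⊆ reverse w) (List.reverse-involutive z) (reverse⁺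
        (same (reverse z) (subst (_≤ depth M) (sym (List.length-reverse z)) z≤)
          (subst (reverse z ⊆_) (List.reverse-involutive (b ∷ w))
            (reverse⁺ (subst (z ⊆_) (sym (List.unfold-reverse b w)) z⊆))))))

-- Words without repeated letters, determined by their subwords of length two

module _ {A : Set} where

  NoRepeat : List A → Set
  NoRepeat l = ∀ a → ¬ (a ∷ a ∷ [] ⊆ l)

  private
    2≤2 : 2 ≤ 2
    2≤2 = ℕ.≤-refl

    1≤2 : 1 ≤ 2
    1≤2 = s≤s z≤n

    -- If the heads differed, b would occur in l, so a b would be a subword of a l and hence of b m.
    -- It would lie inside m, and b would be repeated in b m.
    heads-≡ : ∀ {a b l m} → NoRepeat (b ∷ m) → SameSubwords 2 (a ∷ l) (b ∷ m) → SameSubwords 2 (b ∷ m) (a ∷ l) → a ≡ b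
    heads-≡ {a} {b} {l} {m} nr l→m m→l with m→l [ b ] 1≤2 (refl ∷ minimum m)
    ... | refl ∷ _ = refl
    ... | _ ∷ʳ b⊆l with l→m (a ∷ b ∷ []) 2≤2 (refl ∷ b⊆l)
    ...   | refl ∷ _  = refl
    ...   | _ ∷ʳ ab⊆m = contradiction (refl ∷ ∷ˡ⁻ ab⊆m) (nr b)

    tail-subwords : ∀ {a l m} → NoRepeat (a ∷ l) → SameSubwords 2 (a ∷ l) (a ∷ m) → SameSubwords 2 l m
    tail-subwords {a} nr same z z≤2 z⊆l with same z z≤2 (a ∷ʳ z⊆l)
    ... | _ ∷ʳ z⊆m = z⊆m
    ... | refl ∷ _ = contradiction (refl ∷ ⊆-trans (refl ∷ minimum _) z⊆l) (nr a)

  subwords-determine : ∀ {l m} → NoRepeat l → NoRepeat m → SameSubwords 2 l m → SameSubwords 2 m l → l ≡ m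
  subwords-determine {[]}    {[]}    _ _ _ _ = refl
  subwords-determine {[]}    {b ∷ m} _ _ _ m→l with () ← m→l [ b ] 1≤2 (refl ∷ minimum m)
  subwords-determine {a ∷ l} {[]}    _ _ l→m _ with () ← l→m [ a ] 1≤2 (refl ∷ minimum l)
  subwords-determine {a ∷ l} {b ∷ m} nrl nrm l→m m→l with refl ← heads-≡ nrm l→m m→l =
    cong (a ∷_) (subwords-determine (λ c → nrl c ∘ (a ∷ʳ_)) (λ c → nrm c ∘ (a ∷ʳ_))
      (tail-subwords nrl l→m) (tail-subwords nrm m→l))

  module _ {P : A → Set} (P? : Decidable P) where
    filter-SameSubwords : ∀ {k l m} → SameSubwords k l m → SameSubwords k (filter P? l) (filter P? m)
    filter-SameSubwords {l = l} {m} same z z≤k z⊆ =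
      subst (_⊆ filter P? m) (List.filter-all P? (All-resp-⊆ z⊆ (All.all-filter P? l)))
        (filter⁺ P? P? (λ { refl → id }) (same z z≤k (⊆-trans z⊆ (filter-⊆ P? l))))

-- Decoding the value of a word from its contexts

module Decode (M : FiniteMonoid) (stable : FactorsStabilise M) (stableᵒ : FactorsStabilise (op M))
  (N : FiniteMonoid) (N-J : JTrivial N) (η : Carrier M → Carrier N)
  (recognises : ∀ v w → free N η v ≡ free N η w → SameSubwords (depth M) v w) where

  private
    module M = FiniteMonoid M
    Letter : Set
    Letter = Carrier M
    ∏ : List Letter → Letter
    ∏ = free M id

  ψ : List Letter → Carrier N
  ψ = free N η

  ψ-hom : IsHom N ψ
  ψ-hom = free-isHom N η

  open FiniteMonoid N hiding (Carrier)
  open Contexts N ψ ψ-hom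
  open JTriviality N N-J

  private
    Label : Set
    Label = Carrier N × Letter × Carrier N

    _≟_ : (p q : Carrier N) → Dec (p ≡ q)
    _≟_ = finite⇒≟ finite

    loop? : ∀ e f a → Dec (Loop e f a)
    loop? e f a = ((e ∙ ψ [ a ]) ≟ e) ×-dec ((ψ [ a ] ∙ f) ≟ f)

  Transition : Label → Set
  Transition (e , a , f) = ¬ Loop e f a

  transition? : ∀ σ → Dec (Transition σ)
  transition? (e , a , f) = ¬? (loop? e f a)

  -- A context (p , s), together with the values y and z in M of the words before and after. Labels
  -- do not contain these values, so every pair is provided for.
  Index : Set
  Index = (Carrier N × Carrier N) × (Letter × Letter)

  component : Index → FiniteMonoid
  component (_ , y , z) = Local.local M stable stableᵒ y z

  Active : Index → Label → Set
  Active ((p , s) , _) (e , a , f) = (e ≡ p × f ≡ s) × Loop e f a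

  private
    active? : ∀ i σ → Dec (Active i σ)
    active? ((p , s) , _) (e , a , f) = ((e ≟ p) ×-dec (f ≟ s)) ×-dec loop? e f a

    choose : ∀ {P : Set} (i : Index) → Letter → Dec P → Carrier (component i)
    choose (_ , y , z) a (yes _) = Local.toLocal M stable stableᵒ y z a
    choose i           a (no _)  = FiniteMonoid.ε (component i)

  toComponent : ∀ i → Label → Carrier (component i)
  toComponent i σ@(_ , a , _) = choose i a (active? i σ)

  private
    value : ∀ i → List Label → Carrier (component i)
    value i = free (component i) (toComponent i)

    value-++ : ∀ i k l → value i (k ++ l) ≡ FiniteMonoid._∙_ (component i) (value i k) (value i l)
    value-++ i = free-++ (component i) (toComponent i)

    toComponent-inactive : ∀ i σ → ¬ Active i σ → toComponent i σ ≡ FiniteMonoid.ε (component i)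
    toComponent-inactive i σ ¬act with active? i σ
    ... | yes act = contradiction act ¬act
    ... | no _    = refl

    value-inactive : ∀ i {l} → All (¬_ ∘ Active i) l → value i l ≡ FiniteMonoid.ε (component i)
    value-inactive i []       = refl
    value-inactive i {σ ∷ l} (p ∷ ps) = trans
      (cong₂ (FiniteMonoid._∙_ (component i)) (toComponent-inactive i σ p) (value-inactive i ps))
      (FiniteMonoid.identityˡ (component i) _)

    toComponent-active : ∀ {e f} y z a → Loop e f a →
      toComponent ((e , f) , y , z) (e , a , f) ≡ Local.toLocal M stable stableᵒ y z a
    toComponent-active {e} {f} y z a loop with active? ((e , f) , y , z) (e , a , f)
    ... | yes _ = refl
    ... | no ¬p = contradiction ((refl , refl) , loop) ¬p

    value-active : ∀ {e f} y z {w} → All (Loop e f) w →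
      value ((e , f) , y , z) (map (λ a → e , a , f) w) ≡
      free (Local.local M stable stableᵒ y z) (Local.toLocal M stable stableᵒ y z) w
    value-active y z []       = refl
    value-active y z {a ∷ w} (p ∷ ps) =
      cong₂ (FiniteMonoid._∙_ (Local.local M stable stableᵒ y z)) (toComponent-active y z a p) (value-active y z ps)

    -- Appending a loop to u changes no value of `ψ` and thus adds no short subword, so the value of
    -- u stays in its R-class. Prepending it to v is dual.
    loop-stab : ∀ {e f} u v → ψ u ≡ e → ψ v ≡ f → ∀ {a} → Loop e f a →
                Local.Stab₂ M stable stableᵒ (∏ u) (∏ v) a
    loop-stab u v refl refl {a} (ua , av) =
      Descent.subwords⇒stab M stable u a (recognises _ _ (trans (free-++ N η u [ a ]) ua)) ,
      subwords⇒stab-op M stableᵒ a v (recognises _ _ (trans (free-++ N η [ a ] v) av))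

    decode-loops : ∀ {e f} u v → ψ u ≡ e → ψ v ≡ f → ∀ {w w′} → All (Loop e f) w → All (Loop e f) w′ →
      value ((e , f) , ∏ u , ∏ v) (map (λ a → e , a , f) w) ≡ value ((e , f) , ∏ u , ∏ v) (map (λ a → e , a , f) w′) →
      ∏ u M.∙ ∏ w M.∙ ∏ v ≡ ∏ u M.∙ ∏ w′ M.∙ ∏ v
    decode-loops u v u≡ v≡ {w} {w′} l l′ eq = Local.toLocal-decode M stable stableᵒ (∏ u) (∏ v) w w′
      (All.map (loop-stab u v u≡ v≡) l) (All.map (loop-stab u v u≡ v≡) l′)
      (trans (sym (value-active (∏ u) (∏ v) l)) (trans eq (value-active (∏ u) (∏ v) l′)))

    ψ-∷ : ∀ a w f → ψ (a ∷ w) ∙ f ≡ ψ [ a ] ∙ (ψ w ∙ f)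
    ψ-∷ a w f = trans (cong (_∙ f) (free-++ N η [ a ] w)) (assoc _ _ _)

    ψ-++ : ∀ v w f → ψ (v ++ w) ∙ f ≡ ψ v ∙ (ψ w ∙ f)
    ψ-++ v w f = trans (cong (_∙ f) (free-++ N η v w)) (assoc _ _ _)

    ∈-contexts : ∀ {e w f p a s} → (p , a , s) ∈ contexts e w f →
                 ∃₂ λ v v′ → w ≡ v ++ a ∷ v′ × p ≡ e ∙ ψ v × s ≡ ψ v′ ∙ f
    ∈-contexts {e} {a ∷ w} (here refl) = [] , w , refl , sym (identityʳ e) , refl
    ∈-contexts {e} {b ∷ w} (there σ∈) with v , v′ , w≡ , p≡ , s≡ ← ∈-contexts σ∈ =
      b ∷ v , v′ , cong (b ∷_) w≡ , trans p≡ (trans (assoc _ _ _) (cong (e ∙_) (sym (free-++ N η [ b ] v)))) , s≡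

    -- If (p , a , s) occurs twice, p returns after a has been read, and s is a left multiple of
    -- `ψ [ a ]` ∙ s. R- and L-triviality of N then make a a loop.
    no-repeated-transition : ∀ e w f {σ} → σ ∷ σ ∷ [] ⊆ contexts e w f → ¬ Transition σ
    no-repeated-transition e (_ ∷ w) f (_ ∷ʳ p) t = no-repeated-transition _ w f p t
    no-repeated-transition e (a ∷ w) f (refl ∷ p) t
      with v , v′ , w≡ , p≡ , s≡ ← ∈-contexts (to∈ p) = t
        ( R-trivial (ψ [ a ]) (ψ v) (sym p≡)
        , L-trivial (ψ [ a ]) (ψ v) (begin
            ψ v ∙ (ψ [ a ] ∙ (ψ w ∙ f))  ≡⟨ cong (λ s → ψ v ∙ (ψ [ a ] ∙ s)) s≡ ⟩
            ψ v ∙ (ψ [ a ] ∙ (ψ v′ ∙ f)) ≡⟨ cong (ψ v ∙_) (ψ-∷ a v′ f) ⟨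
            ψ v ∙ (ψ (a ∷ v′) ∙ f)       ≡⟨ ψ-++ v (a ∷ v′) f ⟨
            ψ (v ++ a ∷ v′) ∙ f          ≡⟨ cong (λ w → ψ w ∙ f) w≡ ⟨
            ψ w ∙ f                      ∎) )

    transitions : List Label → List Label
    transitions = filter transition?

    transitions-≡ : ∀ e w w′ f → SameSubwords 2 (contexts e w f) (contexts e w′ f) →
      SameSubwords 2 (contexts e w′ f) (contexts e w f) → transitions (contexts e w f) ≡ transitions (contexts e w′ f)
    transitions-≡ e w w′ f s s′ = subwords-determine (noRepeat w) (noRepeat w′)
      (filter-SameSubwords transition? s) (filter-SameSubwords transition? s′)
      where
      noRepeat : ∀ w → NoRepeat (transitions (contexts e w f))
      noRepeat w σ p with t ∷ _ ← All-resp-⊆ p (All.all-filter transition? (contexts e w f)) =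
        no-repeated-transition e w f (⊆-trans p (filter-⊆ transition? _)) t

    -- Cuts a word at its first transition a. The loops before it have a and w behind them, whence
    -- the suffix value in their condition.
    data Split (e f : Carrier N) : List Letter → Set where
      loops      : ∀ {w} → All (Loop e f) w → Split e f w
      transition : ∀ v a w → All (Loop e (ψ [ a ] ∙ (ψ w ∙ f))) v → ¬ Loop e (ψ w ∙ f) a → Split e f (v ++ a ∷ w)

    split : ∀ e f w → Split e f w
    split e f []      = loops []
    split e f (a ∷ w) with loop? e (ψ w ∙ f) a
    ... | no ¬loop = transition [] a w [] ¬loop
    ... | yes loop with split e f w
    ...   | loops ps = loops (subst (λ f → Loop e f a) (loops-right ps) loop ∷ ps)
    ...   | transition v b w′ ps ¬loop = transition (a ∷ v) b w′ (subst (λ f → Loop e f a) right loop ∷ ps) ¬loop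
      where
      right : ψ (v ++ b ∷ w′) ∙ f ≡ ψ [ b ] ∙ (ψ w′ ∙ f)
      right = begin
        ψ (v ++ b ∷ w′) ∙ f           ≡⟨ ψ-++ v (b ∷ w′) f ⟩
        ψ v ∙ (ψ (b ∷ w′) ∙ f)        ≡⟨ cong (ψ v ∙_) (ψ-∷ b w′ f) ⟩
        ψ v ∙ (ψ [ b ] ∙ (ψ w′ ∙ f))  ≡⟨ loops-right ps ⟩
        ψ [ b ] ∙ (ψ w′ ∙ f)          ∎

    transitions-loops : ∀ e f {w} → All (Loop e f) w → transitions (map (λ a → e , a , f) w) ≡ []
    transitions-loops e f ps = List.filter-none transition? (All.map⁺ (All.map (λ p ¬p → ¬p p) ps))

    -- The suffix value s comes with an equation instead of being computed from w, so that two words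
    -- with the same first transition share one index.
    module FirstTransition (e f s : Carrier N) (v : List Letter) (a : Letter) (w : List Letter) (s≡ : ψ w ∙ f ≡ s)
      (v-loops : All (Loop e (ψ [ a ] ∙ s)) v) (¬loop : ¬ Loop e s a) where

      whole initial final : List Label
      whole   = contexts e (v ++ a ∷ w) f
      initial = map (λ b → e , b , ψ [ a ] ∙ s) v
      final   = contexts (e ∙ ψ [ a ]) w f

      whole-≡ : whole ≡ initial ++ (e , a , s) ∷ final
      whole-≡ = begin
        contexts e (v ++ a ∷ w) f
          ≡⟨ contexts-++ e v (a ∷ w) f ⟩
        contexts e v (ψ (a ∷ w) ∙ f) ++ contexts (e ∙ ψ v) (a ∷ w) f
          ≡⟨ cong₂ (λ g e → contexts _ v g ++ contexts e (a ∷ w) f)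
               (trans (ψ-∷ a w f) (cong (ψ [ a ] ∙_) s≡)) (loops-left v-loops) ⟩
        contexts e v (ψ [ a ] ∙ s) ++ (e , a , ψ w ∙ f) ∷ final
          ≡⟨ cong₂ (λ l s → l ++ (e , a , s) ∷ final) (contexts-loops v-loops) s≡ ⟩
        initial ++ (e , a , s) ∷ final ∎

      transitions-whole : transitions whole ≡ (e , a , s) ∷ transitions final
      transitions-whole = begin
        transitions whole                                             ≡⟨ cong transitions whole-≡ ⟩
        transitions (initial ++ (e , a , s) ∷ final)                  ≡⟨ List.filter-++ transition? initial _ ⟩
        transitions initial ++ transitions ((e , a , s) ∷ final)
          ≡⟨ cong₂ _++_ (transitions-loops e _ v-loops) (List.filter-accept transition? ¬loop) ⟩
        (e , a , s) ∷ transitions final                               ∎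

      value-whole : ∀ i → value i whole ≡ FiniteMonoid._∙_ (component i) (value i initial) (value i final)
      value-whole i = begin
        value i whole                              ≡⟨ cong (value i) whole-≡ ⟩
        value i (initial ++ (e , a , s) ∷ final)   ≡⟨ value-++ i initial _ ⟩
        value i initial ⊙ (toComponent i (e , a , s) ⊙ value i final)
          ≡⟨ cong (λ z → value i initial ⊙ (z ⊙ value i final)) (toComponent-inactive i (e , a , s) (¬loop ∘ proj₂)) ⟩
        value i initial ⊙ (K.ε ⊙ value i final)    ≡⟨ cong (value i initial ⊙_) (K.identityˡ _) ⟩
        value i initial ⊙ value i final            ∎
        where
        module K = FiniteMonoid (component i)
        open K using () renaming (_∙_ to _⊙_)

      -- If the context of the initial loops recurred after a, then e would be a right multiple of e
      -- ∙ `ψ [ a ]` and s a left multiple of `ψ [ a ]` ∙ s. Triviality of N would make a a loop.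
      value-final-here : ∀ yz → value ((e , ψ [ a ] ∙ s) , yz) final ≡ FiniteMonoid.ε (component ((e , ψ [ a ] ∙ s) , yz))
      value-final-here yz = value-inactive ((e , ψ [ a ] ∙ s) , yz) (All.tabulate inactive)
        where
        inactive : ∀ {σ} → σ ∈ final → ¬ Active ((e , ψ [ a ] ∙ s) , yz) σ
        inactive {p , b , q} σ∈ ((p≡e , q≡g) , _) with y , y′ , w≡ , p≡ , q≡ ← ∈-contexts σ∈ = ¬loop
          ( R-trivial (ψ [ a ]) (ψ y) (trans (sym p≡) p≡e)
          , L-trivial (ψ [ a ]) (ψ y ∙ ψ [ b ]) (begin
              ψ y ∙ ψ [ b ] ∙ (ψ [ a ] ∙ s) ≡⟨ cong (ψ y ∙ ψ [ b ] ∙_) (trans (sym q≡g) q≡) ⟩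
              ψ y ∙ ψ [ b ] ∙ (ψ y′ ∙ f)    ≡⟨ assoc _ _ _ ⟩
              ψ y ∙ (ψ [ b ] ∙ (ψ y′ ∙ f))  ≡⟨ cong (ψ y ∙_) (ψ-∷ b y′ f) ⟨
              ψ y ∙ (ψ (b ∷ y′) ∙ f)        ≡⟨ ψ-++ y (b ∷ y′) f ⟨
              ψ (y ++ b ∷ y′) ∙ f           ≡⟨ cong (λ w → ψ w ∙ f) w≡ ⟨
              ψ w ∙ f                       ≡⟨ s≡ ⟩
              s                             ∎) )

      value-initial : ∀ yz → value ((e , ψ [ a ] ∙ s) , yz) whole ≡ value ((e , ψ [ a ] ∙ s) , yz) initial
      value-initial yz = begin
        value i whole                    ≡⟨ value-whole i ⟩
        value i initial ⊙ value i final  ≡⟨ cong (value i initial ⊙_) (value-final-here yz) ⟩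
        value i initial ⊙ K.ε            ≡⟨ K.identityʳ _ ⟩
        value i initial                  ∎
        where
        i : Index
        i = (e , ψ [ a ] ∙ s) , yz
        module K = FiniteMonoid (component i)
        open K using () renaming (_∙_ to _⊙_)

      value-final-elsewhere : ∀ {p q} yz → ¬ (e ≡ p × ψ [ a ] ∙ s ≡ q) →
                              value ((p , q) , yz) whole ≡ value ((p , q) , yz) final
      value-final-elsewhere {p} {q} yz ¬here = begin
        value i whole                    ≡⟨ value-whole i ⟩
        value i initial ⊙ value i final  ≡⟨ cong (_⊙ value i final) (value-inactive i {initial}
                                              (All.map⁺ (All.universal (λ _ → ¬here ∘ proj₁) v))) ⟩
        K.ε ⊙ value i final              ≡⟨ K.identityˡ _ ⟩
        value i final                    ∎
        where
        i : Index
        i = (p , q) , yz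
        module K = FiniteMonoid (component i)
        open K using () renaming (_∙_ to _⊙_)

    -- The component at the values of u and of a w v exchanges y for y′. The prefix u y′ a is then
    -- common to both sides, and `rec` exchanges w for w′ behind it.
    decode-step : ∀ {e f s} u v → ψ u ≡ e → ψ v ≡ f → ∀ y y′ a w w′ → ψ w ∙ f ≡ s → ψ w′ ∙ f ≡ s →
      All (Loop e (ψ [ a ] ∙ s)) y → All (Loop e (ψ [ a ] ∙ s)) y′ → ¬ Loop e s a →
      (∀ i → value i (contexts e (y ++ a ∷ w) f) ≡ value i (contexts e (y′ ++ a ∷ w′) f)) →
      (ψ (u ++ (y′ ++ [ a ])) ≡ e ∙ ψ [ a ] →
       (∀ i → value i (contexts (e ∙ ψ [ a ]) w f) ≡ value i (contexts (e ∙ ψ [ a ]) w′ f)) →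
       ∏ (u ++ (y′ ++ [ a ])) M.∙ ∏ w M.∙ ∏ v ≡ ∏ (u ++ (y′ ++ [ a ])) M.∙ ∏ w′ M.∙ ∏ v) →
      ∏ u M.∙ ∏ (y ++ a ∷ w) M.∙ ∏ v ≡ ∏ u M.∙ ∏ (y′ ++ a ∷ w′) M.∙ ∏ v
    decode-step {e} {f} {s} u v u≡ v≡ y y′ a w w′ w≡ w′≡ p p′ ¬l eq rec = begin
      ∏ u M.∙ ∏ (y ++ a ∷ w) M.∙ ∏ v                  ≡⟨ cong (λ m → ∏ u M.∙ m M.∙ ∏ v) (free-++ M id y (a ∷ w)) ⟩
      ∏ u M.∙ (∏ y M.∙ ∏ (a ∷ w)) M.∙ ∏ v             ≡⟨ regroup (∏ u) (∏ y) (∏ (a ∷ w)) (∏ v) ⟩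
      ∏ u M.∙ ∏ y M.∙ (∏ (a ∷ w) M.∙ ∏ v)             ≡⟨ cong (∏ u M.∙ ∏ y M.∙_) (free-++ M id (a ∷ w) v) ⟨
      ∏ u M.∙ ∏ y M.∙ ∏ ((a ∷ w) ++ v)                ≡⟨ decode-loops u ((a ∷ w) ++ v) u≡ right p p′ initial-eq ⟩
      ∏ u M.∙ ∏ y′ M.∙ ∏ ((a ∷ w) ++ v)               ≡⟨ cong (∏ u M.∙ ∏ y′ M.∙_) (free-++ M id (a ∷ w) v) ⟩
      ∏ u M.∙ ∏ y′ M.∙ (a M.∙ ∏ w M.∙ ∏ v)            ≡⟨ toLeft (∏ w) ⟩
      ∏ (u ++ (y′ ++ [ a ])) M.∙ ∏ w M.∙ ∏ v          ≡⟨ rec left final-eq ⟩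
      ∏ (u ++ (y′ ++ [ a ])) M.∙ ∏ w′ M.∙ ∏ v         ≡⟨ toLeft (∏ w′) ⟨
      ∏ u M.∙ ∏ y′ M.∙ (a M.∙ ∏ w′ M.∙ ∏ v)           ≡⟨ regroup (∏ u) (∏ y′) (∏ (a ∷ w′)) (∏ v) ⟨
      ∏ u M.∙ (∏ y′ M.∙ ∏ (a ∷ w′)) M.∙ ∏ v           ≡⟨ cong (λ m → ∏ u M.∙ m M.∙ ∏ v) (free-++ M id y′ (a ∷ w′)) ⟨
      ∏ u M.∙ ∏ (y′ ++ a ∷ w′) M.∙ ∏ v                ∎
      where
      module F  = FirstTransition e f s y a w w≡ p ¬l
      module F′ = FirstTransition e f s y′ a w′ w′≡ p′ ¬l

      regroup : ∀ k l m n → k M.∙ (l M.∙ m) M.∙ n ≡ k M.∙ l M.∙ (m M.∙ n)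
      regroup k l m n = solve M.monoid

      toLeft : ∀ m → ∏ u M.∙ ∏ y′ M.∙ (a M.∙ m M.∙ ∏ v) ≡ ∏ (u ++ (y′ ++ [ a ])) M.∙ m M.∙ ∏ v
      toLeft m = begin
        ∏ u M.∙ ∏ y′ M.∙ (a M.∙ m M.∙ ∏ v)            ≡⟨ shift (∏ u) (∏ y′) m (∏ v) ⟩
        ∏ u M.∙ (∏ y′ M.∙ ∏ [ a ]) M.∙ m M.∙ ∏ v      ≡⟨ cong (λ l → ∏ u M.∙ l M.∙ m M.∙ ∏ v) (free-++ M id y′ [ a ]) ⟨
        ∏ u M.∙ ∏ (y′ ++ [ a ]) M.∙ m M.∙ ∏ v         ≡⟨ cong (λ l → l M.∙ m M.∙ ∏ v) (free-++ M id u (y′ ++ [ a ])) ⟨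
        ∏ (u ++ (y′ ++ [ a ])) M.∙ m M.∙ ∏ v          ∎
        where
        shift : ∀ k l m n → k M.∙ l M.∙ (a M.∙ m M.∙ n) ≡ k M.∙ (l M.∙ (a M.∙ M.ε)) M.∙ m M.∙ n
        shift k l m n = solve M.monoid

      right : ψ ((a ∷ w) ++ v) ≡ ψ [ a ] ∙ s
      right = begin
        ψ ((a ∷ w) ++ v)        ≡⟨ free-++ N η (a ∷ w) v ⟩
        ψ (a ∷ w) ∙ ψ v         ≡⟨ cong (ψ (a ∷ w) ∙_) v≡ ⟩
        ψ (a ∷ w) ∙ f           ≡⟨ ψ-∷ a w f ⟩
        ψ [ a ] ∙ (ψ w ∙ f)     ≡⟨ cong (ψ [ a ] ∙_) w≡ ⟩
        ψ [ a ] ∙ s             ∎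

      left : ψ (u ++ (y′ ++ [ a ])) ≡ e ∙ ψ [ a ]
      left = begin
        ψ (u ++ (y′ ++ [ a ]))      ≡⟨ free-++ N η u (y′ ++ [ a ]) ⟩
        ψ u ∙ ψ (y′ ++ [ a ])       ≡⟨ cong₂ _∙_ u≡ (free-++ N η y′ [ a ]) ⟩
        e ∙ (ψ y′ ∙ ψ [ a ])        ≡⟨ assoc _ _ _ ⟨
        e ∙ ψ y′ ∙ ψ [ a ]          ≡⟨ cong (_∙ ψ [ a ]) (loops-left p′) ⟩
        e ∙ ψ [ a ]                 ∎

      initial-eq : value ((e , ψ [ a ] ∙ s) , ∏ u , ∏ ((a ∷ w) ++ v)) F.initial ≡
                   value ((e , ψ [ a ] ∙ s) , ∏ u , ∏ ((a ∷ w) ++ v)) F′.initial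
      initial-eq = trans (sym (F.value-initial _)) (trans (eq _) (F′.value-initial _))

      final-eq : ∀ i → value i F.final ≡ value i F′.final
      final-eq ((q , r) , yz) with (e ≟ q) ×-dec ((ψ [ a ] ∙ s) ≟ r)
      ... | yes (refl , refl) = trans (F.value-final-here yz) (sym (F′.value-final-here yz))
      ... | no ¬here = trans (sym (F.value-final-elsewhere yz ¬here)) (trans (eq _) (F′.value-final-elsewhere yz ¬here))

    -- Induction on the common list of transitions: either both words consist of loops, or they have
    -- the same first transition. After each step the prefix u has grown and v is unchanged.
    decode : ∀ ts {e f} u v → ψ u ≡ e → ψ v ≡ f → ∀ {w w′} → Split e f w → Split e f w′ →
      transitions (contexts e w f) ≡ ts → transitions (contexts e w′ f) ≡ ts →
      (∀ i → value i (contexts e w f) ≡ value i (contexts e w′ f)) →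
      ∏ u M.∙ ∏ w M.∙ ∏ v ≡ ∏ u M.∙ ∏ w′ M.∙ ∏ v
    decode [] {e} {f} u v u≡ v≡ (loops p) (loops p′) _ _ eq = decode-loops u v u≡ v≡ p p′
      (trans (cong (value i) (sym (contexts-loops p))) (trans (eq i) (cong (value i) (contexts-loops p′))))
      where
      i : Index
      i = (e , f) , ∏ u , ∏ v
    decode [] {e} {f} u v u≡ v≡ (loops p) (transition y a w′ q ¬l) _ t′ eq
      with () ← trans (sym (FirstTransition.transitions-whole e f _ y a w′ refl q ¬l)) t′
    decode [] {e} {f} u v u≡ v≡ (transition y a w q ¬l) _ t _ eq
      with () ← trans (sym (FirstTransition.transitions-whole e f _ y a w refl q ¬l)) t
    decode (_ ∷ _) {e} {f} u v u≡ v≡ (loops p) _ t _ eq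
      with () ← trans (sym (trans (cong transitions (contexts-loops p)) (transitions-loops e f p))) t
    decode (_ ∷ _) {e} {f} u v u≡ v≡ (transition _ _ _ _ _) (loops p) _ t′ eq
      with () ← trans (sym (trans (cong transitions (contexts-loops p)) (transitions-loops e f p))) t′
    decode (σ ∷ ts) {e} {f} u v u≡ v≡ (transition y a w p ¬l) (transition y′ a′ w′ p′ ¬l′) t t′ eq
      with refl , t₁ ← List.∷-injective (trans (sym (FirstTransition.transitions-whole e f _ y a w refl p ¬l)) t)
         | σ≡ , t₁′ ← List.∷-injective (trans (sym (FirstTransition.transitions-whole e f _ y′ a′ w′ refl p′ ¬l′)) t′)
      -- Only the letters are unified; the suffix values are compound expressions, and their
      -- equality is kept as `s′≡`.
      with refl ← cong (proj₁ ∘ proj₂) σ≡ =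
      decode-step u v u≡ v≡ y y′ a w w′ refl s′≡ p
        (subst (λ s → All (Loop e (ψ [ a ] ∙ s)) y′) s′≡ p′) ¬l eq
        λ left eq′ → decode ts (u ++ (y′ ++ [ a ])) v left v≡ (split _ f w) (split _ f w′) t₁ t₁′ eq′
      where
      s′≡ : ψ w′ ∙ f ≡ ψ w ∙ f
      s′≡ = cong (proj₂ ∘ proj₂) σ≡

  decoding : ∀ w w′ → SameSubwords 2 (τ ψ w) (τ ψ w′) → SameSubwords 2 (τ ψ w′) (τ ψ w) →
    (∀ i → free (component i) (toComponent i) (τ ψ w) ≡ free (component i) (toComponent i) (τ ψ w′)) →
    free M id w ≡ free M id w′
  decoding w w′ same same′ eq = begin
    ∏ w                      ≡⟨ units (∏ w) ⟩
    M.ε M.∙ ∏ w M.∙ M.ε      ≡⟨ decode (transitions (contexts ε w′ ε)) [] [] refl refl (split ε ε w) (split ε ε w′)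
                                  (transitions-≡ ε w w′ ε (subst₂ (SameSubwords 2) w-contexts w′-contexts same)
                                                          (subst₂ (SameSubwords 2) w′-contexts w-contexts same′))
                                  refl (λ i → subst₂ (λ l l′ → value i l ≡ value i l′) w-contexts w′-contexts (eq i)) ⟩
    M.ε M.∙ ∏ w′ M.∙ M.ε     ≡⟨ units (∏ w′) ⟨
    ∏ w′                     ∎
    where
    w-contexts : τ ψ w ≡ contexts ε w ε
    w-contexts = τ≡contexts w
    w′-contexts : τ ψ w′ ≡ contexts ε w′ ε
    w′-contexts = τ≡contexts w′

    units : ∀ m → m ≡ M.ε M.∙ m M.∙ M.ε
    units m = solve M.monoid

-- The factorisation over J, and induction on the level

open FiniteMonoid using (finite)

module _ (n : ℕ) (M : FiniteMonoid) (M-ids : Identities (suc n) M) where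
  private
    stable : FactorsStabilise M
    stable = factorsStabilise n M (proj₁ M-ids)

    stableᵒ : FactorsStabilise (op M)
    stableᵒ = factorsStabilise-op n M (proj₁ M-ids)

  module _ (N : FiniteMonoid) (N-J : JTrivial N) (η : Carrier M → Carrier N)
    (recognises : ∀ v w → free N η v ≡ free N η w → SameSubwords (depth M) v w) where
    private
      module D = Decode M stable stableᵒ N N-J η recognises

      indices-finite : Finite D.Index
      indices-finite = finite-× (finite-× (finite N) (finite N)) (finite-× (finite M) (finite M))

    abstract
      -- The local monoids satisfy the identities one level below those of M. The factor that
      -- records subwords of length two is J-trivial and so satisfies them at any level.
      contextMonoid : Σ[ K ∈ FiniteMonoid ] Σ[ θ ∈ (Carrier N × Carrier M × Carrier N → Carrier K) ] Identities n K ×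
        (∀ w w′ → free K θ (τ D.ψ w) ≡ free K θ (τ D.ψ w′) → free M id w ≡ free M id w′)
      contextMonoid =
        let K₁ , θ₁ , K₁-ids , separates = joint {C = Identities n} (Identities-productClosed n) D.component
              (λ (_ , y , z) → Local.local-Identities M stable stableᵒ y z n M-ids) D.toComponent (elements indices-finite)
            K₂ , θ₂ , K₂-J , recognises₂ = subwords-recognised (finite-× (finite N) (finite-× (finite M) (finite N))) 2
            K , θ , K-ids , both = pair {C = Identities n} (Identities-productClosed n) K₁ K₂ K₁-ids
              (Identities-base n K₂ (JTrivial⇒Identities K₂ K₂-J)) θ₁ θ₂
        in K , θ , K-ids , λ w w′ eq →
          let eq₁ , eq₂ = both (τ D.ψ w) (τ D.ψ w′) eq
          in D.decoding w w′ (recognises₂ (τ D.ψ w) (τ D.ψ w′) eq₂) (recognises₂ (τ D.ψ w′) (τ D.ψ w) (sym eq₂))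
               (λ i → separates (τ D.ψ w) (τ D.ψ w′) eq₁ (∈-elements indices-finite i))

  factorisation : Factors M (λ K → Lift _ (Identities n K)) 𝐉 (free M id)
  factorisation =
    let N , η , N-J , recognises = subwords-recognised (finite M) (depth M)
        K , θ , K-ids , decodes = contextMonoid N N-J η recognises
    in N , K , free N η , free K θ , lift N-J , lift K-ids , free-isHom N η , free-isHom K θ , λ w w′ _ → decodes w w′

characterisation : ∀ n M → 𝐕 (suc n) M ⇔ Identities n M
characterisation zero    M = mk⇔ (λ (lift J) → JTrivial⇒Identities M J) (λ ids → lift (Identities⇒JTrivial M ids))
characterisation (suc n) M = mk⇔
  (λ (_ , _ , _ , φ-hom , φ-surj , N , K , _ , _ , lift N-J , K∈V , ψ-hom , h-hom , factors) →
    product-satisfies M N K φ-hom φ-surj ψ-hom h-hom factors N-J n (Equivalence.to (characterisation n K) K∈V))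
  (λ ids → let N , K , ψ , h , N-J , lift K-ids , homs = factorisation n M ids in
    -- M serves as its own alphabet, each letter evaluating to itself.
    Carrier M , free M id , finite M , free-isHom M id ,
    (λ m → [ m ] , λ { refl → FiniteMonoid.identityʳ M m }) ,
    N , K , ψ , h , N-J , Equivalence.from (characterisation n K) K-ids , homs)

theorem4p1 : (n : ℕ) .{{_ : NonZero n}} (M : FiniteMonoid) →
    𝐕 n M ⇔ ((M ⊨ u n ≈ v n) × (M ⊨ x 1 ^ω ≈ x 1 · x 1 ^ω))
theorem4p1 (suc n) M = characterisation n M
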